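{- The problem Cops and Robber (input: a finite, simple, connected graph $G$ and an integer $k\in\mathbb{N}$; question: is $G$ $k$-copwin?), parameterized by the neighborhood diversity $\mathsf{nd}$ of $G$, admits a kernel with at most $\mathsf{nd}$ vertices.
   Context: Cops and Robber game: two players with perfect information play on a graph $G$. The cop player places each of $k$ cops on a vertex (several cops may share a vertex); then the robber player places one robber on a vertex. Then they alternate moves, cops first. In a cop move, each cop either moves to an adjacent vertex or stays; in a robber move, the robber either moves to an adjacent vertex or stays. The cops win if they have a strategy to capture the robber (some cop occupies the same vertex as the robber) in finitely many moves. $G$ is $k$-copwin if $k$ cops have a winning strategy. Two vertices $u,v$ of $G$ have the same type if $N(v)\setminus\{u\}=N(u)\setminus\{v\}$, where $N(\cdot)$ is the open neighbourhood. The neighborhood diversity $\mathsf{nd}$ of $G$ is the minimum $w$ such that $V(G)$ can be partitioned into at most $w$ sets, all vertices in each set having the same type. A kernel for a parameterized problem is (the output of) a polynomial-time algorithm that maps each instance $I$ with parameter value $p$ to an equivalent instance $I'$ of the same problem (i.e. $I$ is a Yes-instance iff $I'$ is) whose size is bounded by a computable function of $p$. "A kernel with at most $f(p)$ vertices" means that the graph of $I'$ has at most $f(p)$ vertices, where $p$ is the parameter of the input instance. -}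

module Defs where

open import Data.Bool.Base using (Bool; false; T; if_then_else_; _∧_)
import Data.Bool.Properties as Bool
open import Data.Fin.Base using (Fin; finToFun; funToFin)
import Data.Fin.Properties as Fin
open import Data.Fin.Subset using (Subset; _-_)
open import Data.List.Base using (List; []; _∷_; _++_; map; concatMap; allFin)
open import Data.Nat.Base using (ℕ; zero; suc; _+_; _*_; _∸_; _^_; _≤_; z≤n; s≤s; NonZero; _≡ᵇ_)
open import Data.Nat.ListAction using (sum)
open import Data.Nat.Logarithm using (⌊log₂_⌋)
open import Data.Product.Base using (Σ; ∃; ∃-syntax; _×_; _,_; proj₁; proj₂)
open import Data.Sum.Base using (_⊎_)
open import Data.Vec.Base using (tabulate)
import Data.Vec.Properties as Vec
open import Function.Base using (_∘_)
open import Function.Bundles using (_⇔_)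
open import Relation.Binary.Construct.Closure.ReflexiveTransitive using (Star)
open import Relation.Binary.PropositionalEquality using (_≡_; _≢_; refl; subst₂)
open import Relation.Nullary using (Dec; yes; no; contradiction)
open import Relation.Nullary.Decidable using (map′; _→-dec_)
open import Relation.Unary using (Decidable)

record Graph : Set where
  field
    order : ℕ

  V : Set
  V = Fin order

  field
    adj         : V → V → Bool
    adj-sym     : ∀ u v → adj u v ≡ adj v u
    adj-irrefl  : ∀ v → adj v v ≡ false
    nonEmpty    : NonZero order
    connected   : ∀ u v → Star (λ x y → T (adj x y)) u v

  Adj : V → V → Set
  Adj u v = T (adj u v)

  N : V → Subset order
  N u = tabulate (adj u)

module _ (G : Graph) where
  open Graph G

  SameType : V → V → Set
  SameType u v = N v - u ≡ N u - v

  -- A partition into at most w sets is given by the map sending a vertex to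
  -- the index of its set; indices that are not attained are allowed.
  TypePartition : ℕ → Set
  TypePartition w = Σ (V → Fin w) λ part → ∀ u v → part u ≡ part v → SameType u v

  typePartition? : Decidable TypePartition
  typePartition? w = map′
    (λ (i , p) → finToFun i , p)
    (λ (f , p) → funToFin f , λ u v e →
       p u v (subst₂ _≡_ (Fin.finToFun-funToFin f u) (Fin.finToFun-funToFin f v) e))
    (Fin.any? λ i → Fin.all? λ u → Fin.all? λ v →
       (finToFun i u Fin.≟ finToFun i v) →-dec Vec.≡-dec Bool._≟_ (N v - u) (N u - v))

IsMinimum : (ℕ → Set) → ℕ → Set
IsMinimum P m = P m × (∀ w → P w → m ≤ w)

minimum : {P : ℕ → Set} → Decidable P → ∀ n → P n → ∃ (IsMinimum P)
minimum P? zero    p = 0 , p , λ _ _ → z≤n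
minimum P? (suc n) p with P? 0
... | yes p₀ = 0 , p₀ , λ _ _ → z≤n
... | no ¬p₀ with minimum (P? ∘ suc) n p
...   | m , q , least = suc m , q , λ where
          zero    p₀ → contradiction p₀ ¬p₀
          (suc w) r  → s≤s (least w r)

nd-minimum : ∀ G → ∃ (IsMinimum (TypePartition G))
nd-minimum G = minimum (typePartition? G) (Graph.order G) ((λ v → v) , λ { u .u refl → refl })

-- Opaque so that the search is never unfolded; nd-isMinimum specifies it.
opaque
  nd : Graph → ℕ
  nd G = proj₁ (nd-minimum G)

  nd-isMinimum : ∀ G → IsMinimum (TypePartition G) (nd G)
  nd-isMinimum G = proj₂ (nd-minimum G)

module _ (G : Graph) where
  open Graph G

  Move : V → V → Set
  Move u v = u ≡ v ⊎ Adj u v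

  -- A deterministic strategy for k cops.  The argument of `cops` lists all
  -- positions the robber has taken so far, latest first: `cops []` is the
  -- initial placement and `cops (r ∷ h)` is the placement after the cops have
  -- answered the robber's latest position r.
  record CopStrategy (k : ℕ) : Set where
    field
      cops  : List V → Fin k → V
      legal : ∀ r h i → Move (cops h i) (cops (r ∷ h) i)

  -- ρ 0 is the robber's initial vertex, ρ (suc t) the vertex after his
  -- (suc t)-th move.
  RobberPlay : (ℕ → V) → Set
  RobberPlay ρ = ∀ t → Move (ρ t) (ρ (suc t))

  history : (ℕ → V) → ℕ → List V
  history ρ zero    = []
  history ρ (suc t) = ρ t ∷ history ρ t

  -- While the robber is on ρ t, the cops are first placed according to
  -- `history ρ t` and then, after their next move, to `history ρ (suc t)`.
  CapturedAt : ∀ {k} → CopStrategy k → (ℕ → V) → ℕ → Set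
  CapturedAt S ρ t = ∃[ i ] (cops (history ρ t) i ≡ ρ t ⊎ cops (history ρ (suc t)) i ≡ ρ t)
    where open CopStrategy S

  Winning : ∀ {k} → CopStrategy k → Set
  Winning S = ∀ ρ → RobberPlay ρ → ∃[ t ] CapturedAt S ρ t

CopWin : ℕ → Graph → Set
CopWin k G = Σ (CopStrategy G k) (Winning G)

-- Structured programs for a random access machine with
-- arrays and an output tape.  Every operation has unit cost; since the only
-- arithmetic is addition and truncated subtraction (no multiplication), this
-- is polynomially equivalent to Turing machines (Cook and Reckhow, 1973).

infixr 9 _‼_
infixl 6 _⊕_ _⊖_
infix  5 _‼_≔_
infixr 4 _⨾_

-- `a ‼ e` is the cell of the array named a whose index is the value of e.
data Expr : Set where
  lit     : ℕ → Expr
  _‼_     : ℕ → Expr → Expr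
  _⊕_ _⊖_ : Expr → Expr → Expr

data Program : Set where
  skip   : Program
  _‼_≔_  : ℕ → Expr → Expr → Program
  print  : Expr → Program
  _⨾_    : Program → Program → Program
  ifnz   : Expr → Program → Program → Program
  while  : Expr → Program → Program

Memory : Set
Memory = ℕ → ℕ → ℕ

record State : Set where
  constructor ⟪_,_⟫
  field
    mem : Memory
    out : List ℕ

open State public

update : Memory → ℕ → ℕ → ℕ → Memory
update μ a i x b j = if (a ≡ᵇ b) ∧ (i ≡ᵇ j) then x else μ b j

eval : Memory → Expr → ℕ
eval μ (lit n)   = n
eval μ (a ‼ e) = μ a (eval μ e)
eval μ (d ⊕ e)   = eval μ d + eval μ e
eval μ (d ⊖ e)   = eval μ d ∸ eval μ e

cost : Expr → ℕ
cost (lit n)   = 1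
cost (a ‼ e) = suc (cost e)
cost (d ⊕ e)   = suc (cost d + cost e)
cost (d ⊖ e)   = suc (cost d + cost e)

infix 3 _,_⇓[_]_

-- P , σ ⇓[ t ] τ : started in state σ, P halts in state τ after t steps.
data _,_⇓[_]_ : Program → State → ℕ → State → Set where
  skip : ∀ {σ} → skip , σ ⇓[ 1 ] σ

  assign : ∀ {μ o a d e} →
    a ‼ d ≔ e , ⟪ μ , o ⟫ ⇓[ suc (cost d + cost e) ] ⟪ update μ a (eval μ d) (eval μ e) , o ⟫

  print : ∀ {μ o e} →
    print e , ⟪ μ , o ⟫ ⇓[ suc (cost e) ] ⟪ μ , o ++ eval μ e ∷ [] ⟫

  seq : ∀ {P Q σ τ υ s t} →
    P , σ ⇓[ s ] τ → Q , τ ⇓[ t ] υ →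
    P ⨾ Q , σ ⇓[ s + t ] υ

  if-nonzero : ∀ {e P Q σ τ t} →
    eval (mem σ) e ≢ 0 → P , σ ⇓[ t ] τ →
    ifnz e P Q , σ ⇓[ suc (cost e) + t ] τ

  if-zero : ∀ {e P Q σ τ t} →
    eval (mem σ) e ≡ 0 → Q , σ ⇓[ t ] τ →
    ifnz e P Q , σ ⇓[ suc (cost e) + t ] τ

  while-nonzero : ∀ {e P σ τ υ s t} →
    eval (mem σ) e ≢ 0 → P , σ ⇓[ s ] τ → while e P , τ ⇓[ t ] υ →
    while e P , σ ⇓[ suc (cost e) + s + t ] υ

  while-zero : ∀ {e P σ} →
    eval (mem σ) e ≡ 0 →
    while e P , σ ⇓[ suc (cost e) ] σ

nth : List ℕ → ℕ → ℕ
nth []       i       = 0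
nth (x ∷ xs) zero    = x
nth (x ∷ xs) (suc i) = nth xs i

-- The input is stored in array 0; all other cells are 0.
load : List ℕ → State
load xs = ⟪ (λ { zero → nth xs ; (suc _) _ → 0 }) , [] ⟫

_maps_to_within_ : Program → List ℕ → List ℕ → ℕ → Set
P maps xs to ys within t = ∃[ τ ] (P , load xs ⇓[ t ] τ) × out τ ≡ ys

Computable : (ℕ → ℕ) → Set
Computable f = ∃[ P ] ∀ n → ∃[ t ] P maps (n ∷ []) to (f n ∷ []) within t

-- The number of binary digits of all entries.
size : List ℕ → ℕ
size xs = sum (map (λ x → suc ⌊log₂ x ⌋) xs)

record ParameterizedProblem : Set₁ where
  field
    Instance  : Set
    Yes       : Instance → Set
    parameter : Instance → ℕ
    encode    : Instance → List ℕ

module _ (Π : ParameterizedProblem) where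
  open ParameterizedProblem Π

  PolynomialTime : (Instance → Instance) → Set
  PolynomialTime K = ∃[ P ] ∃[ c ] ∃[ d ] ∀ I → ∃[ t ]
    (P maps encode I to encode (K I) within t) × t ≤ c * size (encode I) ^ d + c

  record IsKernel (K : Instance → Instance) : Set where
    field
      polynomialTime : PolynomialTime K
      equivalent     : ∀ I → Yes I ⇔ Yes (K I)
      bounded        : ∃[ f ] Computable f × (∀ I → size (encode (K I)) ≤ f (parameter I))

record CRInstance : Set where
  field
    graph : Graph
    k     : ℕ

-- The number of vertices, the number of cops, and the adjacency matrix row by
-- row.
encodeCR : CRInstance → List ℕ
encodeCR I = order ∷ k ∷ concatMap (λ u → map (λ v → if adj u v then 1 else 0) (allFin order)) (allFin order)
  where
  open CRInstance I
  open Graph graph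

CopsAndRobber/nd : ParameterizedProblem
CopsAndRobber/nd = record
  { Instance  = CRInstance
  ; Yes       = λ I → CopWin (CRInstance.k I) (CRInstance.graph I)
  ; parameter = λ I → nd (CRInstance.graph I)
  ; encode    = encodeCR
  }

{-# OPTIONS --safe #-}
module Submission where

-- Call two vertices twins if they have the same type.  The quotient of G by
-- twins, with one representative per class, is an induced subgraph onto which
-- G retracts, so k cops who win on G win on the quotient.  Conversely, cops who
-- catch the robber's image in the quotient pin him down: a cop on a twin of the
-- robber's vertex reaches every vertex to which he could flee, and any second
-- cop then walks up to him.  Hence for k ≠ 1 the quotient is an equivalent
-- instance, and k can be capped at its number of vertices.  For k = 1 the
-- second cop is missing (the 4-cycle needs two cops, its quotient only one),
-- but one-cop games are decided in polynomial time by backward induction over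
-- the positions, and the answer is encoded in a one-vertex instance.

open import Defs
open import Data.Bool.Base using (Bool; true; false; T; if_then_else_)
import Data.Bool.Properties as Bool
open import Data.Empty using (⊥)
open import Data.Fin.Base using (Fin; zero; suc; toℕ; combine; remQuot; punchIn)
import Data.Fin.Base as Fin
import Data.Fin.Properties as Fin
open import Data.Fin.Subset using (Subset; _-_; _∈_; ∣_∣)
open import Data.Fin.Subset.Properties using (p─⊥≡p; p⊂q⇒∣p∣<∣q∣; ∣p∣≤n)
open import Data.List.Base using
  (List; []; _∷_; [_]; _++_; map; filter; foldr; allFin; length; applyUpTo; concat; concatMap; tabulate)
import Data.List.Base as List
open import Data.List.Membership.Propositional.Properties using (∈-filter⁺; ∈-filter⁻; ∈-lookup; ∈-allFin)
open import Data.List.Properties using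
  (map-tabulate; tabulate-lookup; length-tabulate; concatMap-map; map-∘; concatMap-cong;
   ++-assoc; ++-identityʳ; concat-map-[_]; length-++; length-map; map-++)
import Data.List.Relation.Unary.All as All
open import Data.List.Relation.Unary.AllPairs using (_∷_)
import Data.List.Relation.Unary.Any as Any
open import Data.List.Relation.Unary.Any.Properties using (lookup-index)
open import Data.List.Relation.Unary.Unique.Propositional using (Unique)
import Data.List.Relation.Unary.Unique.Propositional.Properties as Unique
open import Data.Nat.Base hiding (_%_)
open import Data.Nat.DivMod using (_%_; m%n<n; m<n⇒m%n≡m)
open import Data.Nat.ListAction using (sum)
open import Data.Nat.ListAction.Properties using (sum-++)
open import Data.Nat.Logarithm using (⌊log₂_⌋; ⌊log₂⌋-mono-≤; ⌊log₂[2^n]⌋≡n)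
open import Data.Nat.Properties
open import Data.Nat.Solver using (module +-*-Solver)
open import Data.Product.Base using (Σ; ∃; ∃-syntax; _×_; _,_; proj₁; proj₂; map₂)
open import Data.Sum.Base using (_⊎_; inj₁; inj₂; [_,_]′)
open import Data.Unit.Base using (tt)
open import Data.Vec.Base using (Vec; []; _∷_; lookup)
import Data.Vec.Base as Vec
open import Data.Vec.Functional using (updateAt)
open import Data.Vec.Functional.Properties using (updateAt-updates; updateAt-minimal)
import Data.Vec.Properties as Vec
open import Function.Base using (_∘_; id; const)
open import Function.Bundles using (_⇔_; mk⇔)
open import Function.Construct.Composition using (_⇔-∘_)
open import Relation.Binary.Construct.Closure.ReflexiveTransitive using (Star; ε; _◅_)
open import Relation.Binary.Definitions using (tri<; tri≈; tri>)
open import Relation.Binary.PropositionalEquality hiding ([_])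
open import Relation.Nullary using (Dec; yes; no; ¬_; ¬?; contradiction; does)
open import Relation.Nullary.Decidable using
  (T?; _⊎-dec_; _×-dec_; _→-dec_; decidable-stable; dec-true; dec-false)
open import Relation.Unary using (Decidable)

-- Polynomial time is here a claim about an explicit machine program, so the kernel is written in a
-- small language whose only iteration ranges over the numbers below the order of the graph. One
-- compiler proof then yields correctness and cost together, and running times are polynomial by
-- structural induction. As the machine has no multiplication, conditions are expressed by sums and
-- truncated subtraction. The program never computes `nd`: it finds the classes of twins directly,
-- and only the proof compares their number with `nd`. Capping `k` matters because the size of the
-- output includes the digits of `k`, which `nd` does not bound.

-- Total correctness with time bounds for machine programs

update-same : ∀ μ a i x → update μ a i x a i ≡ x
update-same μ a i x with a ≡ᵇ a | ≡⇒≡ᵇ a a refl | i ≡ᵇ i | ≡⇒≡ᵇ i i refl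
... | true | _ | true | _ = refl

update-other : ∀ μ a i x b j → ¬ (a ≡ b × i ≡ j) → update μ a i x b j ≡ μ b j
update-other μ a i x b j ≢ with a ≡ᵇ b in p | i ≡ᵇ j in q
... | false | _     = refl
... | true  | false = refl
... | true  | true  = contradiction (≡ᵇ⇒≡ a b (subst T (sym p) tt) , ≡ᵇ⇒≡ i j (subst T (sym q) tt)) ≢

-- A Hoare-style assertion with a time budget. The budget is only an upper bound, since it has to be
-- known from the program text and the order alone, whereas actual times depend on the branches
-- taken.
record Runs (P : Program) (σ : State) (b : ℕ) (Q : State → Set) : Set where
  constructor runs
  field
    {time}     : ℕ
    {final}    : State
    derivation : P , σ ⇓[ time ] final
    inTime     : time ≤ b
    post       : Q final

assign-runs : ∀ {a d e σ Q} →
  Q ⟪ update (mem σ) a (eval (mem σ) d) (eval (mem σ) e) , out σ ⟫ →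
  Runs (a ‼ d ≔ e) σ (suc (cost d + cost e)) Q
assign-runs q = runs assign ≤-refl q

seq-runs : ∀ {P P′ σ b b′ Q Q′} → Runs P σ b Q → (∀ {τ} → Q τ → Runs P′ τ b′ Q′) →
  Runs (P ⨾ P′) σ (b + b′) Q′
seq-runs (runs p t q) r with r q
... | runs p′ t′ q′ = runs (seq p p′) (+-mono-≤ t t′) q′

loop : {S : Set} → (ℕ → S → S) → ℕ → S → S
loop f zero    s = s
loop f (suc n) s = loop (f ∘ suc) n (f 0 s)

countUp : ℕ → Program → Program
countUp c P = 1 ‼ lit c ≔ lit 0 ⨾ while (0 ‼ lit 0 ⊖ 1 ‼ lit c) (P ⨾ 1 ‼ lit c ≔ 1 ‼ lit c ⊕ lit 1)

-- Initialising the counter costs 3, each test of the guard 6 (including the last, failing one) and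
-- each increment 6; `b` is the budget of the body.
countUpTime : ℕ → ℕ → ℕ
countUpTime n b = 3 + (n * (6 + (b + 6)) + 6)

module _ {S : Set} (Inv : S → State → Set) (c : ℕ) {P : Program} {n b : ℕ}
  (bound : ∀ {s σ} → Inv s σ → mem σ 0 0 ≡ n)
  (stable : ∀ {s μ o x} → Inv s ⟪ μ , o ⟫ → Inv s ⟪ update μ 1 c x , o ⟫)
  where

  -- Here `i` rounds are over and `f` has been shifted by `i`, matching the recursion of `loop`. The
  -- counter belongs to the loop, so the body must hand it back unchanged.
  Body : (ℕ → S → S) → ℕ → Set
  Body f i = ∀ j {s σ} → mem σ 1 c ≡ i + j → Inv s σ →
    Runs P σ b (λ τ → mem τ 1 c ≡ i + j × Inv (f j s) τ)

  while-runs : ∀ m i f → Body f i → i + m ≡ n → ∀ {s σ} → mem σ 1 c ≡ i → Inv s σ →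
    Runs (while (0 ‼ lit 0 ⊖ 1 ‼ lit c) (P ⨾ 1 ‼ lit c ≔ 1 ‼ lit c ⊕ lit 1)) σ
      (m * (6 + (b + 6)) + 6) (Inv (loop f m s))
  while-runs zero i f body i+m≡n {σ = σ} ci inv = runs (while-zero guard) ≤-refl inv
    where
    guard : mem σ 0 0 ∸ mem σ 1 c ≡ 0
    guard = trans (cong₂ _∸_ (trans (bound inv) (trans (sym i+m≡n) (+-identityʳ i))) ci) (n∸n≡0 i)
  while-runs (suc m) i f body i+m≡n {s} {σ} ci inv
    with body 0 (trans ci (sym (+-identityʳ i))) inv
  ... | runs {tb} {τ} d t (ci′ , inv′)
    with while-runs m (suc i) (f ∘ suc) (λ j e → body′ j e)
           (trans (sym (+-suc i m)) i+m≡n) {f 0 s} {⟪ update (mem τ) 1 c (mem τ 1 c + 1) , out τ ⟫}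
           (trans (update-same (mem τ) 1 c _) (trans (cong (_+ 1) (trans ci′ (+-identityʳ i))) (+-comm i 1)))
           (stable inv′)
    where
    body′ : Body (f ∘ suc) (suc i)
    body′ j e inv″ with body (suc j) (trans e (sym (+-suc i j))) inv″
    ... | runs d₁ t₁ (c₁ , q₁) = runs d₁ t₁ (trans c₁ (+-suc i j) , q₁)
  ... | runs {tw} d′ t′ q = runs (while-nonzero guard (seq d assign) d′) time≤ q
    where
    guard : mem σ 0 0 ∸ mem σ 1 c ≢ 0
    guard z = contradiction (trans (sym eq) z) λ ()
      where
      eq : mem σ 0 0 ∸ mem σ 1 c ≡ suc m
      eq = trans (cong₂ _∸_ (trans (bound inv) (sym i+m≡n)) ci) (m+n∸m≡n i (suc m))
    time≤ : 6 + (tb + 6) + tw ≤ suc m * (6 + (b + 6)) + 6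
    time≤ = ≤-trans (+-mono-≤ (+-monoʳ-≤ 6 (+-monoˡ-≤ 6 t)) t′)
                    (≤-reflexive (sym (+-assoc (6 + (b + 6)) (m * (6 + (b + 6))) 6)))

  countUp-runs : ∀ f → Body f 0 → ∀ {s σ} → Inv s σ → Runs (countUp c P) σ (countUpTime n b) (Inv (loop f n s))
  countUp-runs f body {σ = σ} inv = seq-runs
    (assign-runs {Q = λ τ → mem τ 1 c ≡ 0 × Inv _ τ} (update-same (mem σ) 1 c 0 , stable inv))
    (λ (c0 , inv′) → while-runs n 0 f body refl c0 inv′)

-- A language of bounded loops and its semantics

-- Variables are de Bruijn indices.  Every sum and every loop ranges over the
-- numbers below the first input cell, so that running times are polynomials in
-- that number.

infixl 6 _⊕_ _⊖_
infixr 4 _⨾_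

data Term (v : ℕ) : Set where
  lit        : ℕ → Term v
  var        : Fin v → Term v
  input work : Term v → Term v
  _⊕_ _⊖_    : Term v → Term v → Term v
  ∑          : Term (suc v) → Term v

data Command (v : ℕ) : Set where
  skip  : Command v
  print : Term v → Command v
  store : Term v → Term v → Command v
  _⨾_   : Command v → Command v → Command v
  ifnz  : Term v → Command v → Command v → Command v
  for   : Command (suc v) → Command v

Array : Set
Array = ℕ → ℕ

-- α is the input array and ω the work array.
⟦_⟧ : ∀ {v} → Term v → Array → Array → Vec ℕ v → ℕ
⟦ lit n   ⟧ α ω ρ = n
⟦ var x   ⟧ α ω ρ = lookup ρ x
⟦ input e ⟧ α ω ρ = α (⟦ e ⟧ α ω ρ)
⟦ work e  ⟧ α ω ρ = ω (⟦ e ⟧ α ω ρ)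
⟦ d ⊕ e   ⟧ α ω ρ = ⟦ d ⟧ α ω ρ + ⟦ e ⟧ α ω ρ
⟦ d ⊖ e   ⟧ α ω ρ = ⟦ d ⟧ α ω ρ ∸ ⟦ e ⟧ α ω ρ
⟦ ∑ e     ⟧ α ω ρ = sum (applyUpTo (λ i → ⟦ e ⟧ α ω (i ∷ ρ)) (α 0))

branch : {A : Set} → ℕ → A → A → A
branch zero    x y = y
branch (suc _) x y = x

exec : ∀ {v} → Array → Command v → Vec ℕ v → Array × List ℕ → Array × List ℕ
exec α skip         ρ s       = s
exec α (print e)    ρ (ω , o) = ω , o ++ ⟦ e ⟧ α ω ρ ∷ []
exec α (store d e)  ρ (ω , o) = (λ j → if ⟦ d ⟧ α ω ρ ≡ᵇ j then ⟦ e ⟧ α ω ρ else ω j) , o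
exec α (c ⨾ d)      ρ s       = exec α d ρ (exec α c ρ s)
exec α (ifnz e c d) ρ s       = branch (⟦ e ⟧ α (proj₁ s) ρ) (exec α c ρ s) (exec α d ρ s)
exec α (for c)      ρ s       = loop (λ i → exec α c (i ∷ ρ)) (α 0) s

-- The compiler, its running time and its correctness

-- The compiled code keeps its variables and temporaries in array 1, used as a
-- stack of height h; the vector Γ holds the stack positions of the variables.
-- The work array is array 2.
compileTerm : ∀ {v} → ℕ → Vec ℕ v → Term v → Program
compileTerm h Γ (lit n)   = 1 ‼ lit h ≔ lit n
compileTerm h Γ (var x)   = 1 ‼ lit h ≔ 1 ‼ lit (lookup Γ x)
compileTerm h Γ (input e) = compileTerm h Γ e ⨾ 1 ‼ lit h ≔ 0 ‼ 1 ‼ lit h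
compileTerm h Γ (work e)  = compileTerm h Γ e ⨾ 1 ‼ lit h ≔ 2 ‼ 1 ‼ lit h
compileTerm h Γ (d ⊕ e)   = compileTerm h Γ d ⨾ compileTerm (suc h) Γ e ⨾ 1 ‼ lit h ≔ 1 ‼ lit h ⊕ 1 ‼ lit (suc h)
compileTerm h Γ (d ⊖ e)   = compileTerm h Γ d ⨾ compileTerm (suc h) Γ e ⨾ 1 ‼ lit h ≔ 1 ‼ lit h ⊖ 1 ‼ lit (suc h)
compileTerm h Γ (∑ e)     = 1 ‼ lit h ≔ lit 0 ⨾
  countUp (suc h) (compileTerm (2 + h) (suc h ∷ Γ) e ⨾ 1 ‼ lit h ≔ 1 ‼ lit h ⊕ 1 ‼ lit (2 + h))

compile : ∀ {v} → ℕ → Vec ℕ v → Command v → Program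
compile h Γ skip         = skip
compile h Γ (print e)    = compileTerm h Γ e ⨾ print (1 ‼ lit h)
compile h Γ (store d e)  = compileTerm h Γ d ⨾ compileTerm (suc h) Γ e ⨾ 2 ‼ (1 ‼ lit h) ≔ 1 ‼ lit (suc h)
compile h Γ (c ⨾ d)      = compile h Γ c ⨾ compile h Γ d
compile h Γ (ifnz e c d) = compileTerm h Γ e ⨾ ifnz (1 ‼ lit h) (compile h Γ c) (compile h Γ d)
compile h Γ (for c)      = countUp h (compile (suc h) (h ∷ Γ) c)

termTime : ∀ {v} → Term v → ℕ → ℕ
termTime (lit _)   n = 3
termTime (var _)   n = 4
termTime (input e) n = termTime e n + 5
termTime (work e)  n = termTime e n + 5
termTime (d ⊕ e)   n = termTime d n + (termTime e n + 7)
termTime (d ⊖ e)   n = termTime d n + (termTime e n + 7)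
termTime (∑ e)     n = 3 + countUpTime n (termTime e n + 7)

commandTime : ∀ {v} → Command v → ℕ → ℕ
commandTime skip         n = 1
commandTime (print e)    n = termTime e n + 3
commandTime (store d e)  n = termTime d n + (termTime e n + 5)
commandTime (c ⨾ d)      n = commandTime c n + commandTime d n
-- Adding the times of both branches bounds their maximum and keeps all running times within sums
-- and products.
commandTime (ifnz e c d) n = termTime e n + (3 + (commandTime c n + commandTime d n))
commandTime (for c)      n = countUpTime n (commandTime c n)

-- The frame condition: evaluating a term at stack height `h` may disturb only the stack from `h`
-- upwards, and no cell of any other array.
Agree : ℕ → Memory → Memory → Set
Agree h μ ν = ∀ a j → (a ≡ 1 → j < h) → ν a j ≡ μ a j

agree-trans : ∀ {h μ ν ξ} → Agree h μ ν → Agree h ν ξ → Agree h μ ξ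
agree-trans p q a j g = trans (q a j g) (p a j g)

agree-lower : ∀ {h h′ μ ν} → h ≤ h′ → Agree h′ μ ν → Agree h μ ν
agree-lower h≤h′ p a j g = p a j (λ e → ≤-trans (g e) h≤h′)

agree-update : ∀ {h} μ c x → h ≤ c → Agree h μ (update μ 1 c x)
agree-update μ c x h≤c a j g =
  update-other μ 1 c x a j λ (e , e′) → <⇒≱ (g (sym e)) (subst (_ ≤_) e′ h≤c)

update-agree : ∀ {h μ ν} c x → h ≤ c → Agree h μ ν → Agree h μ (update ν 1 c x)
update-agree {ν = ν} c x h≤c p = agree-trans p (agree-update ν c x h≤c)

Below : ∀ {v} → ℕ → Vec ℕ v → Set
Below h Γ = ∀ x → lookup Γ x < h

below-bind : ∀ {v h} {Γ : Vec ℕ v} → Below h Γ → Below (suc h) (h ∷ Γ)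
below-bind b zero    = ≤-refl
below-bind b (suc x) = m<n⇒m<1+n (b x)

record Models (α ω : Array) {v} (Γ ρ : Vec ℕ v) (μ : Memory) : Set where
  constructor models
  field
    inputs    : ∀ j → μ 0 j ≡ α j
    works     : ∀ j → μ 2 j ≡ ω j
    variables : ∀ x → μ 1 (lookup Γ x) ≡ lookup ρ x
open Models

models-agree : ∀ {α ω v h μ ν} {Γ ρ : Vec ℕ v} → Below h Γ → Agree h μ ν →
  Models α ω Γ ρ μ → Models α ω Γ ρ ν
models-agree b p (models i w x) = models
  (λ j → trans (p 0 j λ ()) (i j))
  (λ j → trans (p 2 j λ ()) (w j))
  (λ y → trans (p 1 _ λ _ → b y) (x y))

models-bind : ∀ {α ω v h i μ} {Γ ρ : Vec ℕ v} → μ 1 h ≡ i → Models α ω Γ ρ μ →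
  Models α ω (h ∷ Γ) (i ∷ ρ) μ
models-bind e (models i w x) = models i w λ where
  zero    → e
  (suc y) → x y

Evaluates : ℕ → State → ℕ → State → Set
Evaluates h σ x τ = Agree h (mem σ) (mem τ) × mem τ 1 h ≡ x × out τ ≡ out σ

private
  unary-runs : ∀ {P h σ b x e} → Runs P σ b (Evaluates h σ x) → (f : ℕ → ℕ) →
    (∀ {τ} → Evaluates h σ x τ → eval (mem τ) e ≡ f x) →
    Runs (P ⨾ 1 ‼ lit h ≔ e) σ (b + suc (1 + cost e)) (Evaluates h σ (f x))
  unary-runs {h = h} {e = e} r f ev = seq-runs r λ {τ} q@(ag , val , o) →
    assign-runs (update-agree h _ ≤-refl ag , trans (update-same (mem τ) 1 h _) (ev q) , o)

  binary-runs : ∀ {P Q h σ b b′ x y e} → Runs P σ b (Evaluates h σ x) →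
    (∀ {τ} → Agree h (mem σ) (mem τ) → Runs Q τ b′ (Evaluates (suc h) τ y)) → (f : ℕ → ℕ → ℕ) →
    (∀ {τ} → eval (mem τ) e ≡ f (mem τ 1 h) (mem τ 1 (suc h))) →
    Runs (P ⨾ Q ⨾ 1 ‼ lit h ≔ e) σ (b + (b′ + suc (1 + cost e))) (Evaluates h σ (f x y))
  binary-runs {h = h} {e = e} r r′ f ev = seq-runs r λ {τ} (ag , val , o) →
    seq-runs (r′ ag) λ {υ} (ag′ , val′ , o′) →
    assign-runs
      ( update-agree h _ ≤-refl (agree-trans ag (agree-lower (n≤1+n h) ag′))
      , trans (update-same (mem υ) 1 h _)
          (trans (ev {υ}) (cong₂ f (trans (ag′ 1 h λ _ → ≤-refl) val) val′))
      , trans o′ o )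

loop-sum : ∀ g n a → loop (λ i a → a + g i) n a ≡ a + sum (applyUpTo g n)
loop-sum g zero    a = sym (+-identityʳ a)
loop-sum g (suc n) a = trans (loop-sum (g ∘ suc) n (a + g 0)) (+-assoc a (g 0) _)

compileTerm-correct : ∀ {v α ω} (e : Term v) h {Γ ρ σ} → Below h Γ → Models α ω Γ ρ (mem σ) →
  Runs (compileTerm h Γ e) σ (termTime e (α 0)) (Evaluates h σ (⟦ e ⟧ α ω ρ))
compileTerm-correct (lit n) h {σ = σ} b m =
  assign-runs (agree-update (mem σ) h n ≤-refl , update-same (mem σ) 1 h n , refl)
compileTerm-correct (var x) h {σ = σ} b m =
  assign-runs (agree-update (mem σ) h _ ≤-refl , trans (update-same (mem σ) 1 h _) (variables m x) , refl)
compileTerm-correct {α = α} (input e) h {σ = σ} b m =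
  unary-runs (compileTerm-correct e h b m) α λ {τ} (ag , val , _) →
    trans (inputs (models-agree b ag m) (mem τ 1 h)) (cong α val)
compileTerm-correct {ω = ω} (work e) h {σ = σ} b m =
  unary-runs (compileTerm-correct e h b m) ω λ {τ} (ag , val , _) →
    trans (works (models-agree b ag m) (mem τ 1 h)) (cong ω val)
compileTerm-correct (d ⊕ e) h b m =
  binary-runs (compileTerm-correct d h b m)
    (λ ag → compileTerm-correct e (suc h) (λ x → m<n⇒m<1+n (b x)) (models-agree b ag m)) _+_ refl
compileTerm-correct (d ⊖ e) h b m =
  binary-runs (compileTerm-correct d h b m)
    (λ ag → compileTerm-correct e (suc h) (λ x → m<n⇒m<1+n (b x)) (models-agree b ag m)) _∸_ refl
compileTerm-correct {α = α} {ω} (∑ e) h {Γ} {ρ} {σ} b m = seq-runs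
  (assign-runs (agree-update (mem σ) h 0 ≤-refl , update-same (mem σ) 1 h 0 , refl))
  λ ev → subst (λ x → Runs _ _ _ (Evaluates h σ x)) (loop-sum g (α 0) 0)
    -- The loop state is the running total, held in slot `h`; slot `suc h` is the counter and
    -- doubles as the bound variable of the sum.
    (countUp-runs (λ x → Evaluates h σ x) (suc h)
      (λ (ag , _) → inputs (models-agree b ag m) 0)
      (λ {_} {μ} {_} {x} (ag , val , o) → update-agree (suc h) _ (n≤1+n h) ag ,
         trans (update-other μ 1 (suc h) x 1 h (λ (_ , s) → 1+n≢n s)) val , o)
      (λ i a → a + g i) body ev)
  where
  g : ℕ → ℕ
  g i = ⟦ e ⟧ α ω (i ∷ ρ)

  body : ∀ i {a τ} → mem τ 1 (suc h) ≡ i → Evaluates h σ a τ →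
    Runs (compileTerm (2 + h) (suc h ∷ Γ) e ⨾ 1 ‼ lit h ≔ 1 ‼ lit h ⊕ 1 ‼ lit (2 + h)) τ
      (termTime e (α 0) + 7) (λ υ → mem υ 1 (suc h) ≡ i × Evaluates h σ (a + g i) υ)
  body i {a} {τ} ci (ag , val , o) = seq-runs
    (compileTerm-correct e (2 + h) (below-bind (λ x → m<n⇒m<1+n (b x))) (models-bind ci (models-agree b ag m)))
    λ {υ} (ag′ , val′ , o′) → assign-runs
      ( trans (update-other (mem υ) 1 h _ 1 (suc h) (λ (_ , s) → 1+n≢n (sym s))) (trans (ag′ 1 (suc h) λ _ → ≤-refl) ci)
      , update-agree h _ ≤-refl (agree-trans ag (agree-lower (m≤n+m h 2) ag′))
      , trans (update-same (mem υ) 1 h _) (cong₂ _+_ (trans (ag′ 1 h λ _ → s≤s (n≤1+n h)) val) val′)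
      , trans o′ o )

Represents : (α : Array) {v : ℕ} (Γ ρ : Vec ℕ v) → Array × List ℕ → State → Set
Represents α Γ ρ (ω , o) σ = Models α ω Γ ρ (mem σ) × out σ ≡ o

compile-correct : ∀ {v α} (c : Command v) h {Γ ρ s σ} → Below h Γ → Represents α Γ ρ s σ →
  Runs (compile h Γ c) σ (commandTime c (α 0)) (Represents α Γ ρ (exec α c ρ s))
compile-correct skip h b r = runs skip ≤-refl r
compile-correct (print e) h b (m , refl) = seq-runs (compileTerm-correct e h b m)
  λ (ag , val , o) → runs print ≤-refl (models-agree b ag m , cong₂ (λ o x → o ++ x ∷ []) o val)
compile-correct {α = α} (store d e) h {ρ = ρ} {s = ω , _} b (m , o) =
  seq-runs (compileTerm-correct d h b m) λ (ag , val , o₁) →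
  seq-runs (compileTerm-correct e (suc h) (λ x → m<n⇒m<1+n (b x)) (models-agree b ag m)) λ {υ} (ag′ , val′ , o₂) →
  let m′ = models-agree b (agree-trans ag (agree-lower (n≤1+n h) ag′)) m in
  assign-runs
    ( models (inputs m′)
        (λ j → cong₂ (λ i z → if i ≡ᵇ j then z else _) (trans (ag′ 1 h λ _ → ≤-refl) val) val′
               ▸ cong (λ z → if ⟦ d ⟧ α ω ρ ≡ᵇ j then ⟦ e ⟧ α ω ρ else z) (works m′ j))
        (variables m′)
    , trans o₂ (trans o₁ o) )
  where
  infixr 2 _▸_
  _▸_ = trans
compile-correct (c ⨾ d) h b r =
  seq-runs (compile-correct c h b r) λ r′ → compile-correct d h b r′
compile-correct {α = α} (ifnz e c d) h {Γ} {ρ} {s} {σ} b (m , o) =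
  seq-runs (compileTerm-correct e h b m) λ (ag , val , o′) →
  choose (⟦ e ⟧ α (proj₁ s) ρ) val (models-agree b ag m , trans o′ o)
  where
  choose : ∀ x {τ} → mem τ 1 h ≡ x → Represents α Γ ρ s τ →
    Runs (ifnz (1 ‼ lit h) (compile h Γ c) (compile h Γ d)) τ
      (3 + (commandTime c (α 0) + commandTime d (α 0)))
      (Represents α Γ ρ (branch x (exec α c ρ s) (exec α d ρ s)))
  choose zero val r with compile-correct d h b r
  ... | runs p t q = runs (if-zero val p) (+-monoʳ-≤ 3 (m≤n⇒m≤o+n _ t)) q
  choose (suc _) val r with compile-correct c h b r
  ... | runs p t q = runs (if-nonzero (λ z → contradiction (trans (sym val) z) λ ()) p) (+-monoʳ-≤ 3 (m≤n⇒m≤n+o _ t)) q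
compile-correct {α = α} (for c) h {Γ} {ρ} b r = countUp-runs (Represents α Γ ρ) h
  (λ (m , _) → inputs m 0)
  (λ {_} {μ} {_} {x} (m , o) → models-agree b (agree-update μ h x ≤-refl) m , o)
  (λ i → exec α c (i ∷ ρ))
  body r
  where
  body : ∀ i {s σ} → mem σ 1 h ≡ i → Represents α Γ ρ s σ →
    Runs (compile (suc h) (h ∷ Γ) c) σ (commandTime c (α 0))
      (λ τ → mem τ 1 h ≡ i × Represents α Γ ρ (exec α c (i ∷ ρ) s) τ)
  body i ci (m , o) with compile-correct c (suc h) (below-bind b) (models-bind ci m , o)
  ... | runs p t (m′ , o′) = runs p t (variables m′ zero , models (inputs m′) (works m′) (λ x → variables m′ (suc x)) , o′)

result : Command 0 → List ℕ → List ℕ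
result c xs = proj₂ (exec (nth xs) c [] ((λ _ → 0) , []))

program : Command 0 → Program
program = compile 0 []

program-correct : ∀ c xs → ∃[ t ] (program c maps xs to result c xs within t) × t ≤ commandTime c (nth xs 0)
program-correct c xs with compile-correct {α = nth xs} c 0 {[]} {[]} {(λ _ → 0) , []} {load xs} (λ ())
                            (models (λ _ → refl) (λ _ → refl) (λ ()) , refl)
... | runs p t (_ , o) = _ , (_ , p , o) , t

-- Strategies as automata, and twins

module _ (G : Graph) where
  open Graph G

  adj-≢ : ∀ {u v} → Adj u v → u ≢ v
  adj-≢ {u} a refl = subst T (adj-irrefl u) a

  adj-symmetric : ∀ {u v} → Adj u v → Adj v u
  adj-symmetric {u} {v} = subst T (adj-sym u v)

  move? : ∀ u v → Dec (Move G u v)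
  move? u v = (u Fin.≟ v) ⊎-dec T? (adj u v)

  stay : ∀ {u} → Move G u u
  stay = inj₁ refl

  -- Histories list the latest position first, so `foldr` feeds them to `step` in the order of play.
  machine : ∀ {k} {S : Set} (place : S → Fin k → V) (step : V → S → S) → S →
    (∀ r s i → Move G (place s i) (place (step r s) i)) → CopStrategy G k
  machine place step s₀ legal = record
    { cops  = place ∘ foldr step s₀
    ; legal = λ r h → legal r (foldr step s₀ h)
    }

  -- The pointwise form of `SameType`, free of subsets and hence directly decidable and computable.
  Twins : V → V → Set
  Twins u v = ∀ x → x ≢ u → x ≢ v → adj u x ≡ adj v x

  twins? : ∀ u v → Dec (Twins u v)
  twins? u v = Fin.all? λ x → ¬? (x Fin.≟ u) →-dec ¬? (x Fin.≟ v) →-dec (adj u x Bool.≟ adj v x)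

  twins-refl : ∀ {u} → Twins u u
  twins-refl _ _ _ = refl

  twins-sym : ∀ {u v} → Twins u v → Twins v u
  twins-sym t x x≢v x≢u = sym (t x x≢u x≢v)

  twins-trans : ∀ {u v w} → Twins u v → Twins v w → Twins u w
  twins-trans {u} {v} {w} s t x x≢u x≢w with x Fin.≟ v
  ... | no x≢v = trans (s x x≢u x≢v) (t x x≢v x≢w)
  ... | yes refl with u Fin.≟ w
  ...   | yes refl = refl
  -- Neither hypothesis says anything at the middle vertex; symmetry of adjacency turns the question
  -- into one about `u` and `w`, where they do apply.
  ...   | no u≢w = begin
    adj u x ≡⟨ adj-sym u x ⟩
    adj x u ≡⟨ t u (x≢u ∘ sym) u≢w ⟩
    adj w u ≡⟨ adj-sym w u ⟩
    adj u w ≡⟨ s w (u≢w ∘ sym) (x≢w ∘ sym) ⟩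
    adj x w ≡⟨ adj-sym x w ⟩
    adj w x ∎
    where open ≡-Reasoning

  twins-adj : ∀ {u v x} → Twins u v → x ≢ u → Adj v x → Adj u x
  twins-adj {x = x} t x≢u a = subst T (sym (t x x≢u (adj-≢ a ∘ sym))) a

lookup-remove : ∀ {n} (p : Subset n) {u x} → x ≢ u → lookup (p - u) x ≡ lookup p x
lookup-remove (s ∷ p) {zero}  {zero}  x≢u = contradiction refl x≢u
lookup-remove (s ∷ p) {zero}  {suc x} x≢u = cong (λ q → lookup q x) (p─⊥≡p p)
lookup-remove (s ∷ p) {suc u} {zero}  x≢u = refl
lookup-remove (s ∷ p) {suc u} {suc x} x≢u = lookup-remove p (x≢u ∘ cong suc)

sameType⇒twins : ∀ G {u v} → SameType G u v → Twins G u v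
sameType⇒twins G {u} {v} same x x≢u x≢v = begin
  adj u x            ≡⟨ Vec.lookup∘tabulate (adj u) x ⟨
  lookup (N u) x     ≡⟨ lookup-remove (N u) x≢v ⟨
  lookup (N u - v) x ≡⟨ cong (λ p → lookup p x) same ⟨
  lookup (N v - u) x ≡⟨ lookup-remove (N v) x≢u ⟩
  lookup (N v) x     ≡⟨ Vec.lookup∘tabulate (adj v) x ⟩
  adj v x            ∎
  where
  open Graph G
  open ≡-Reasoning

lookup-injective : ∀ {A : Set} {xs : List A} → Unique xs → ∀ i j → List.lookup xs i ≡ List.lookup xs j → i ≡ j
lookup-injective (_ ∷ _)  zero    zero    _ = refl
lookup-injective (x ∷ _)  zero    (suc j) e = contradiction e (All.lookup x (∈-lookup j))
lookup-injective (x ∷ _)  (suc i) zero    e = contradiction (sym e) (All.lookup x (∈-lookup i))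
lookup-injective (_ ∷ xs) (suc i) (suc j) e = cong suc (lookup-injective xs i j e)

history-map : ∀ {H K : Graph} (f : Graph.V H → Graph.V K) ρ t → history K (f ∘ ρ) t ≡ map f (history H ρ t)
history-map f ρ zero    = refl
history-map f ρ (suc t) = cong (_ ∷_) (history-map f ρ t)

-- The quotient by twins as a retract

module Quotient (G : Graph) where
  open Graph G

  -- Taking the least index as representative makes the choice a condition that the program can test
  -- at each vertex separately.
  IsLeast : V → Set
  IsLeast u = ¬ ∃ λ v → v Fin.< u × Twins G v u

  isLeast? : ∀ u → Dec (IsLeast u)
  isLeast? u = ¬? (Fin.any? λ v → (v Fin.<? u) ×-dec twins? G v u)

  representatives : List V
  representatives = filter isLeast? (allFin order)

  V′ : Set
  V′ = Fin (length representatives)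

  embed : V′ → V
  embed = List.lookup representatives

  least-twin : ∀ v → ∃ λ u → IsLeast u × Twins G u v
  least-twin v with Fin.¬∀⟶∃¬-smallest order (λ u → ¬ Twins G u v) (λ u → ¬? (twins? G u v)) (λ f → f v (twins-refl G))
  ... | u , ¬¬t , smallest = u , least , t
    where
    t : Twins G u v
    t = decidable-stable (twins? G u v) ¬¬t
    least : IsLeast u
    least (w , w<u , s) = smallest (Fin.fromℕ< w<u)
      (subst (λ w → Twins G w v)
             (Fin.toℕ-injective (sym (trans (Fin.toℕ-inject _) (Fin.toℕ-fromℕ< w<u)))) (twins-trans G s t))

  class : ∀ v → ∃ λ i → Twins G (embed i) v
  class v with least-twin v
  ... | u , least , t = Any.index u∈ , subst (λ w → Twins G w v) (lookup-index u∈) t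
    where u∈ = ∈-filter⁺ isLeast? (∈-allFin u) least

  fold : V → V′
  fold = proj₁ ∘ class

  fold-twins : ∀ v → Twins G (embed (fold v)) v
  fold-twins = proj₂ ∘ class

  embed-least : ∀ i → IsLeast (embed i)
  embed-least i = proj₂ (∈-filter⁻ isLeast? {xs = allFin order} (∈-lookup i))

  embed-separates : ∀ {i j} → Twins G (embed i) (embed j) → i ≡ j
  embed-separates {i} {j} t with Fin.<-cmp (embed i) (embed j)
  ... | tri< l _ _ = contradiction (_ , l , t) (embed-least j)
  ... | tri> _ _ g = contradiction (_ , g , twins-sym G t) (embed-least i)
  ... | tri≈ _ e _ = lookup-injective (Unique.filter⁺ isLeast? (Unique.allFin⁺ order)) i j e

  fold-embed : ∀ i → fold (embed i) ≡ i
  fold-embed i = embed-separates (fold-twins (embed i))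

  Move′ : V′ → V′ → Set
  Move′ i j = i ≡ j ⊎ Adj (embed i) (embed j)

  -- The ends are replaced by their representatives one at a time. A replacement can fail only if
  -- the new end meets the other one, and then both ends lie in one class, so the edge collapses.
  fold-adj : ∀ {u v} → Adj u v → Move′ (fold u) (fold v)
  fold-adj {u} {v} a with fold u Fin.≟ fold v
  ... | yes e = inj₁ e
  ... | no ≢  = inj₂ (adj-symmetric G (twins-adj G (fold-twins v)
      (λ e → ≢ (embed-separates (subst (λ x → Twins G (embed (fold u)) x) e (twins-refl G))))
      (adj-symmetric G (twins-adj G (fold-twins u)
        (λ e → ≢ (embed-separates (subst (λ x → Twins G x (embed (fold v))) e (twins-sym G (fold-twins v))))) a))))

  fold-move : ∀ {u v} → Move G u v → Move′ (fold u) (fold v)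
  fold-move (inj₁ refl) = inj₁ refl
  fold-move (inj₂ a)    = fold-adj a

  fold-star : ∀ {u v} → Star Adj u v → Star (λ i j → Adj (embed i) (embed j)) (fold u) (fold v)
  fold-star ε = ε
  fold-star {u} (_◅_ {j = w} a s) with fold u | fold w | fold-adj a | fold-star s
  ... | _ | _ | inj₁ refl | s′ = s′
  ... | _ | _ | inj₂ a′   | s′ = a′ ◅ s′

  quotient : Graph
  quotient = record
    { order      = length representatives
    ; adj        = λ i j → adj (embed i) (embed j)
    ; adj-sym    = λ i j → adj-sym (embed i) (embed j)
    ; adj-irrefl = λ i → adj-irrefl (embed i)
    ; nonEmpty   = Fin.nonZeroIndex (fold (Fin.fromℕ< {0} (>-nonZero⁻¹ order {{nonEmpty}})))
    ; connected  = λ i j → subst₂ (Star _) (fold-embed i) (fold-embed j) (fold-star (connected (embed i) (embed j)))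
    }

  -- `nd G` is attained by some type partition, and two representatives in one of its sets would be
  -- twins, hence equal.
  order≤nd : Graph.order quotient ≤ nd G
  order≤nd with nd-isMinimum G
  ... | (part , same) , _ = Fin.injective⇒≤ {f = part ∘ embed}
    (λ e → embed-separates (sameType⇒twins G (same _ _ e)))

  -- A robber on the quotient is also a robber on `G` through `embed`. The answers of the cops are
  -- folded back, and captures survive because `fold` is a left inverse of `embed`.
  copWin-fold : ∀ {k} → CopWin k G → CopWin k quotient
  copWin-fold (S , wins) = record
    { cops  = λ h i → fold (cops (map embed h) i)
    ; legal = λ r h i → fold-move (legal (embed r) (map embed h) i)
    } , λ ρ play → captured ρ (wins (embed ∘ ρ) (λ t → [ inj₁ ∘ cong embed , inj₂ ]′ (play t)))
    where
    open CopStrategy S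
    captured : ∀ ρ → _ → _
    captured ρ (t , i , c) = t , i , [ inj₁ ∘ hit t , inj₂ ∘ hit (suc t) ]′ c
      where
      hit : ∀ s → cops (history G (embed ∘ ρ) s) i ≡ embed (ρ t) → fold (cops (map embed (history quotient ρ s)) i) ≡ ρ t
      hit s e = trans
        (cong fold (trans (cong (λ h → cops h i) (sym (history-map {quotient} {G} embed ρ s))) e)) (fold-embed (ρ t))

  -- The cops play on G against the image of the robber in the quotient.  Once
  -- that image is caught, the robber sits on a twin of a cop i and cannot leave
  -- without stepping next to i, while a second cop j walks up to him.
  module Unfold {k} (S : CopStrategy quotient (2 + k)) where
    open CopStrategy S

    shadow : List V → Fin (2 + k) → V
    shadow h = embed ∘ cops (map fold h)

    -- In `hunt`, cop `i` stands on the twin and cop `j` follows the walk. The start `q` of the walk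
    -- is a variable tied to `C j` by an equation, so that the walk can be matched on.
    data Phase : Set where
      chase : List V → Phase
      hunt  : (C : Fin (2 + k) → V) (i j : Fin (2 + k)) {q r : V} → C j ≡ q → Star Adj q r → Phase
      done  : (Fin (2 + k) → V) → Phase

    place : Phase → Fin (2 + k) → V
    place (chase h)        = shadow h
    place (hunt C _ _ _ _) = C
    place (done C)         = C

    shift : (Fin (2 + k) → V) → Fin (2 + k) → V → Fin (2 + k) → V
    shift C i v = updateAt C i (const v)

    shift-move : ∀ C i {v} → Move G (C i) v → ∀ l → Move G (C l) (shift C i v l)
    shift-move C i {v} m l with l Fin.≟ i
    ... | yes refl = subst (Move G (C i)) (sym (updateAt-updates i C)) m
    ... | no l≢i   = inj₁ (sym (updateAt-minimal l i C l≢i))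

    Caught : List V → V → Fin (2 + k) → Set
    Caught h r i = shadow h i ≡ embed (fold r) ⊎ shadow (r ∷ h) i ≡ embed (fold r)

    caught? : ∀ h r → Dec (∃ (Caught h r))
    caught? h r = Fin.any? λ i → (shadow h i Fin.≟ embed (fold r)) ⊎-dec (shadow (r ∷ h) i Fin.≟ embed (fold r))

    begin-hunt : (C : Fin (2 + k) → V) → Fin (2 + k) → V → Phase
    -- `punchIn i zero` is an index different from `i`; it exists because there are at least two
    -- cops.
    begin-hunt C i r = hunt C i (punchIn i zero) refl (connected (C (punchIn i zero)) r)

    react : ∀ r h → Dec (∃ (Caught h r)) → Phase
    -- The image was caught before the cops answered, so all of them stay: moving on could take cop
    -- `i` off the twin.
    react r h (yes (i , inj₁ _)) = begin-hunt (shadow h) i r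
    react r h (yes (i , inj₂ _)) = begin-hunt (shadow (r ∷ h)) i r
    react r h (no _)             = chase (r ∷ h)

    pursue : ∀ r C i j {q r₀} → C j ≡ q → Star Adj q r₀ → Dec (Move G (C i) r) → Phase
    pursue r C i j e w                 (yes _) = done (shift C i r)
    -- The walk is used up: in the play considered, cop `j` already stands on the robber.
    pursue r C i j e ε                 (no _)  = done C
    pursue r C i j e (_◅_ {j = v} _ w) (no _)  = hunt (shift C j v) i j (updateAt-updates j C) w

    step : V → Phase → Phase
    step r (chase h)        = react r h (caught? h r)
    step r (hunt C i j e w) = pursue r C i j e w (move? G (C i) r)
    step r (done C)         = done C

    shadow-move : ∀ r h i → Move G (shadow h i) (shadow (r ∷ h) i)
    shadow-move r h i = [ inj₁ ∘ cong embed , inj₂ ]′ (legal (fold r) (map fold h) i)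

    react-legal : ∀ r h d l → Move G (shadow h l) (place (react r h d) l)
    react-legal r h (yes (i , inj₁ _)) l = stay G
    react-legal r h (yes (i , inj₂ _)) l = shadow-move r h l
    react-legal r h (no _)             l = shadow-move r h l

    pursue-legal : ∀ r C i j {q r₀} (e : C j ≡ q) (w : Star Adj q r₀) d l →
      Move G (C l) (place (pursue r C i j e w d) l)
    pursue-legal r C i j e    w       (yes m) l = shift-move C i m l
    pursue-legal r C i j e    ε       (no _)  l = stay G
    pursue-legal r C i j refl (a ◅ w) (no _)  l = shift-move C j (inj₂ a) l

    step-legal : ∀ r p l → Move G (place p l) (place (step r p) l)
    step-legal r (chase h)        = react-legal r h (caught? h r)
    step-legal r (hunt C i j e w) = pursue-legal r C i j e w (move? G (C i) r)
    step-legal r (done C) l       = stay G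

    strategy : CopStrategy G (2 + k)
    strategy = machine G place step (chase []) step-legal

    module _ (ρ : ℕ → V) (play : RobberPlay G ρ) where

      phase : ℕ → Phase
      phase t = foldr step (chase []) (history G ρ t)

      Captured : Set
      Captured = ∃ (CapturedAt G strategy ρ)

      -- Induction on the walk of cop `j`. If the robber leaves along an edge, he ends on or next to
      -- cop `i`, who stands on his twin; so whenever cop `i` cannot strike, the robber has stood
      -- still and the target of the walk remains right. The decision `d` is tied to the play by
      -- `next`, so that it can be split as a plain argument.
      pursue-captures : ∀ t C i j {q r} (e : C j ≡ q) (w : Star Adj q r) (d : Dec (Move G (C i) (ρ (suc t)))) →
        i ≢ j → r ≡ ρ t → Twins G (C i) (ρ t) →
        phase (suc t) ≡ hunt C i j e w → phase (2 + t) ≡ pursue (ρ (suc t)) C i j e w d → Captured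
      pursue-captures t C i j e w (yes _) _ _ _ _ next =
        suc t , i , inj₂ (trans (cong (λ p → place p i) next) (updateAt-updates i C))
      pursue-captures t C i j e w (no ¬m) i≢j refl twin now next with play t
      ... | inj₂ a = contradiction (inj₂ (twins-adj G twin (λ e → ¬m (inj₁ (sym e))) a)) ¬m
      pursue-captures t C i j e ε (no ¬m) i≢j refl twin now next | inj₁ stays =
        suc t , j , inj₁ (trans (cong (λ p → place p j) now) (trans e stays))
      pursue-captures t C i j e (_◅_ {j = v} a w) (no ¬m) i≢j refl twin now next | inj₁ stays =
        pursue-captures (suc t) (shift C j v) i j (updateAt-updates j C) w (move? G _ _) i≢j stays
          (subst₂ (Twins G) (sym (updateAt-minimal i j C i≢j)) stays twin)
          next (cong (step (ρ (2 + t))) next)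

      begin-hunt-captures : ∀ t C i → C i ≡ embed (fold (ρ t)) → phase (suc t) ≡ begin-hunt C i (ρ t) → Captured
      begin-hunt-captures t C i e now = pursue-captures t C i _ refl _ (move? G _ _)
        (Fin.punchInᵢ≢i i zero ∘ sym) refl (subst (λ u → Twins G u (ρ t)) (sym e) (fold-twins (ρ t)))
        now (cong (step (ρ (suc t))) now)

      react-captures : ∀ t d → phase (suc t) ≡ react (ρ t) (history G ρ t) d →
        ∃ (Caught (history G ρ t) (ρ t)) → Captured
      react-captures t (yes (i , inj₁ e)) now _ = begin-hunt-captures t _ i e now
      react-captures t (yes (i , inj₂ e)) now _ = begin-hunt-captures t _ i e now
      react-captures t (no ¬c)            now c = contradiction c ¬c

      chasing-or-captured : ∀ t → phase t ≡ chase (history G ρ t) ⊎ Captured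
      chasing-or-captured zero = inj₁ refl
      chasing-or-captured (suc t) with chasing-or-captured t
      ... | inj₂ c   = inj₂ c
      ... | inj₁ now = continue (caught? (history G ρ t) (ρ t)) (cong (step (ρ t)) now)
        where
        continue : ∀ d → phase (suc t) ≡ react (ρ t) (history G ρ t) d →
          phase (suc t) ≡ chase (history G ρ (suc t)) ⊎ Captured
        continue (yes c) next = inj₂ (react-captures t (yes c) next c)
        continue (no _)  next = inj₁ next

      captures : Winning quotient S → Captured
      captures wins with wins (fold ∘ ρ) fold-play
        where
        fold-play : RobberPlay quotient (fold ∘ ρ)
        fold-play t = fold-move (play t)
      ... | t , i , c with chasing-or-captured t
      ...   | inj₂ captured = captured
      ...   | inj₁ now = react-captures t (caught? _ _) (cong (step (ρ t)) now)
          (i , [ inj₁ ∘ hit t , inj₂ ∘ hit (suc t) ]′ c)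
        where
        hit : ∀ s → cops (history quotient (fold ∘ ρ) s) i ≡ fold (ρ t) → shadow (history G ρ s) i ≡ embed (fold (ρ t))
        hit s e = cong embed (trans (cong (λ h → cops h i) (sym (history-map {G} {quotient} fold ρ s))) e)

  copWin-unfold : ∀ k → CopWin (2 + k) quotient → CopWin (2 + k) G
  copWin-unfold k (S , wins) = Unfold.strategy S , λ ρ play → Unfold.captures S ρ play wins

-- Capping the number of cops

copWin-cover : ∀ {G k} → Graph.order G ≤ k → CopWin k G
copWin-cover {G} {k} n≤k = record
  { cops  = λ _ i → start i
  ; legal = λ _ _ _ → stay G
  } , λ ρ _ → 0 , Fin.inject≤ (ρ 0) n≤k , inj₁ (covers (ρ 0))
  where
  open Graph G
  instance nonEmpty-order = nonEmpty
  start : Fin k → V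
  -- The remainder gives surplus cops a vertex as well.
  start i = Fin.fromℕ< (m%n<n (toℕ i) order)
  covers : ∀ v → start (Fin.inject≤ v n≤k) ≡ v
  covers v = Fin.toℕ-injective (begin
    toℕ (start (Fin.inject≤ v n≤k))     ≡⟨ Fin.toℕ-fromℕ< _ ⟩
    toℕ (Fin.inject≤ v n≤k) % order     ≡⟨ cong (_% order) (Fin.toℕ-inject≤ v n≤k) ⟩
    toℕ v % order                       ≡⟨ m<n⇒m%n≡m (Fin.toℕ<n v) ⟩
    toℕ v                               ∎)
    where open ≡-Reasoning

copWin-⊓ : ∀ {G} k → CopWin k G ⇔ CopWin (k ⊓ Graph.order G) G
copWin-⊓ {G} k with ≤-total k (Graph.order G)
... | inj₁ k≤n = mk⇔ (subst (λ l → CopWin l G) (sym (m≤n⇒m⊓n≡m k≤n))) (subst (λ l → CopWin l G) (m≤n⇒m⊓n≡m k≤n))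
... | inj₂ n≤k = mk⇔ (λ _ → copWin-cover (≤-reflexive (sym (m≥n⇒m⊓n≡n n≤k)))) (λ _ → copWin-cover n≤k)

no-copWin-zero : ∀ {G} → ¬ CopWin 0 G
no-copWin-zero {G} (_ , wins) with wins (const (Fin.fromℕ< (>-nonZero⁻¹ order {{nonEmpty}}))) (λ _ → inj₁ refl)
  where open Graph G
... | _ , () , _

copWin-quotient : ∀ G k → k ≢ 1 → CopWin k G ⇔ CopWin k (Quotient.quotient G)
copWin-quotient G 0             _   = mk⇔ (λ w → contradiction w no-copWin-zero) (λ w → contradiction w no-copWin-zero)
copWin-quotient G 1             k≢1 = contradiction refl k≢1
copWin-quotient G (suc (suc k)) _   = mk⇔ (Quotient.copWin-fold G) (Quotient.copWin-unfold G k)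

-- The game with one cop: backward induction

-- Stage t r c says that a cop on c wins within t rounds against a robber on r
-- who is about to move.
module OneCop (G : Graph) where
  open Graph G

  Reaches : (V → V → Set) → V → V → Set
  Reaches W c r = ∃ λ y → Move G c y × W r y

  -- The monotone operator whose iterates are the stages. It takes an arbitrary relation because the
  -- program applies it to a partly updated array of marks.
  Attack : (V → V → Set) → V → V → Set
  Attack W r c = r ≡ c ⊎ (∀ x → Move G r x → Reaches W c x)

  attack-mono : ∀ {W W′ : V → V → Set} → (∀ r c → W r c → W′ r c) → ∀ r c → Attack W r c → Attack W′ r c
  attack-mono W⊆W′ r c (inj₁ e) = inj₁ e
  attack-mono W⊆W′ r c (inj₂ f) = inj₂ λ x m → map₂ (λ {y} → map₂ (W⊆W′ x y)) (f x m)

  Stage : ℕ → V → V → Set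
  Stage zero    _ _ = ⊥
  Stage (suc t)     = Attack (Stage t)

  reaches? : ∀ {W} → (∀ r c → Dec (W r c)) → ∀ c r → Dec (Reaches W c r)
  reaches? W? c r = Fin.any? λ y → move? G c y ×-dec W? r y

  stage? : ∀ t r c → Dec (Stage t r c)
  stage? zero    r c = no λ ()
  stage? (suc t) r c = (r Fin.≟ c) ⊎-dec
    Fin.all? λ x → move? G r x →-dec reaches? (stage? t) c x

  _⊑_ : ℕ → ℕ → Set
  s ⊑ t = ∀ r c → Stage s r c → Stage t r c

  ⊑-step : ∀ s t → s ⊑ t → suc s ⊑ suc t
  ⊑-step s t = attack-mono {Stage s} {Stage t}

  ⊑-suc : ∀ t → t ⊑ suc t
  ⊑-suc zero    r c ()
  ⊑-suc (suc t) = ⊑-step t (suc t) (⊑-suc t)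

  ⊑-mono : ∀ {s t} → s ≤ t → s ⊑ t
  ⊑-mono z≤n               r c ()
  ⊑-mono (s≤s {s} {t} s≤t) = ⊑-step s t (⊑-mono s≤t)

  stable⇒greatest : ∀ t → suc t ⊑ t → ∀ s → s ⊑ t
  stable⇒greatest t st zero    r c ()
  stable⇒greatest t st (suc s) r c w = st r c (⊑-step s t (stable⇒greatest t st s) r c w)

  rounds : ℕ
  rounds = order * order

  unpair : Fin rounds → V × V
  unpair = remQuot {order} order

  StageAt : ℕ → V × V → Set
  StageAt t (r , c) = Stage t r c

  stageAt? : ∀ t p → Dec (StageAt t p)
  stageAt? t (r , c) = stage? t r c

  stageSet : ℕ → Subset rounds
  stageSet t = Vec.tabulate λ p → does (stageAt? t (unpair p))

  ∈-stageSet⁺ : ∀ t p → StageAt t (unpair p) → p ∈ stageSet t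
  ∈-stageSet⁺ t p w = Vec.lookup⇒[]= p (stageSet t) (trans (Vec.lookup∘tabulate _ p) (dec-true (stageAt? t (unpair p)) w))

  ∈-stageSet⁻ : ∀ t p → p ∈ stageSet t → StageAt t (unpair p)
  ∈-stageSet⁻ t p p∈ = decidable-stable (stageAt? t (unpair p)) λ ¬w → contradiction
    (trans (sym (Vec.[]=⇒lookup p∈)) (trans (Vec.lookup∘tabulate _ p) (dec-false (stageAt? t (unpair p)) ¬w))) λ ()

  -- As long as no stage is stable, each one gains a position over its predecessor. There are only
  -- `rounds` positions, so stability occurs by stage `rounds`.
  stable-or-large : ∀ t → (∃ λ s → s < t × suc s ⊑ s) ⊎ t ≤ ∣ stageSet t ∣
  stable-or-large zero = inj₂ z≤n
  stable-or-large (suc t) with stable-or-large t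
  ... | inj₁ (s , s<t , st) = inj₁ (s , m<n⇒m<1+n s<t , st)
  ... | inj₂ large with Fin.any? (λ r → Fin.any? (λ c → stage? (suc t) r c ×-dec ¬? (stage? t r c)))
  ...   | no none = inj₁ (t , ≤-refl , λ r c w → decidable-stable (stage? t r c) λ ¬w → none (r , c , w , ¬w))
  ...   | yes (r , c , w , ¬w) = inj₂ (≤-<-trans large (p⊂q⇒∣p∣<∣q∣
      ( (λ {p} p∈ → ∈-stageSet⁺ (suc t) p (⊑-suc t _ _ (∈-stageSet⁻ t p p∈)))
      , combine r c
      , ∈-stageSet⁺ (suc t) (combine r c) (subst (StageAt (suc t)) (sym (Fin.remQuot-combine r c)) w)
      , λ p∈ → ¬w (subst (StageAt t) (Fin.remQuot-combine r c) (∈-stageSet⁻ t (combine r c) p∈)))))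

  rounds-greatest : ∀ s → s ⊑ rounds
  rounds-greatest s with stable-or-large (suc rounds)
  ... | inj₁ (t , t<1+n , st) = λ r c w → ⊑-mono {t} {rounds} (s≤s⁻¹ t<1+n) r c (stable⇒greatest t st s r c w)
  ... | inj₂ large = contradiction (∣p∣≤n (stageSet (suc rounds))) (<⇒≱ large)

  CanReach : V → V → Set
  CanReach = Reaches (Stage rounds)

  canReach? : ∀ c r → Dec (CanReach c r)
  canReach? = reaches? (stage? rounds)

  GoodStart : Set
  GoodStart = ∃ λ c → ∀ r → CanReach c r

  goodStart? : Dec GoodStart
  goodStart? = Fin.any? λ c → Fin.all? (canReach? c)

  module _ (start : V) (good : ∀ r → CanReach start r) where

    step : V → V × ℕ → V × ℕ
    step r (c , zero)  = c , zero
    step r (c , suc t) with reaches? (stage? t) c r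
    ... | yes (y , _) = y , t
    ... | no _        = c , t

    step-legal : ∀ r s → Move G (proj₁ s) (proj₁ (step r s))
    step-legal r (c , zero)  = stay G
    step-legal r (c , suc t) with reaches? (stage? t) c r
    ... | yes (_ , m , _) = m
    ... | no _            = stay G

    strategy : CopStrategy G 1
    -- The extra round is the answer to the robber's placement, which leads into stage `rounds`.
    strategy = machine G (λ s _ → proj₁ s) step (start , suc rounds) (λ r s _ → step-legal r s)

    step-stage : ∀ t c r → Reaches (Stage t) c r →
      ∃ λ y → step r (c , suc t) ≡ (y , t) × Stage t r y
    step-stage t c r w with reaches? (stage? t) c r
    ... | yes (y , _ , w′) = y , refl , w′
    ... | no ¬w            = contradiction w ¬w

    module _ (ρ : ℕ → V) (play : RobberPlay G ρ) where

      stage-captures : ∀ s t c → foldr step (start , suc rounds) (history G ρ (suc t)) ≡ (c , s) →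
        Stage s (ρ t) c → ∃ (CapturedAt G strategy ρ)
      stage-captures (suc s) t c now (inj₁ e) = t , zero , inj₂ (trans (cong proj₁ now) (sym e))
      stage-captures (suc s) t c now (inj₂ f) with step-stage s c (ρ (suc t)) (f _ (play t))
      ... | y , next , w = stage-captures s (suc t) y (trans (cong (step (ρ (suc t))) now) next) w

      captures : ∃ (CapturedAt G strategy ρ)
      captures with step-stage rounds start (ρ 0) (good (ρ 0))
      ... | y , next , w = stage-captures rounds 0 y next w

  goodStart⇒copWin : GoodStart → CopWin 1 G
  goodStart⇒copWin (c , good) = strategy c good , captures c good

  module _ (S : CopStrategy G 1) where
    open CopStrategy S

    cop : List V → V
    cop h = cops h zero

    -- The robber's invariant with the cop to move: no move of the cop reaches a won position.
    Safe : List V × V → Set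
    Safe (h , r) = ¬ CanReach (cop h) r

    -- Stage `rounds` is closed under `Attack`. Outside it the attack condition fails too, and
    -- finiteness with decidability turns this failure into an explicit move.
    escape : ∀ c r → ¬ Stage rounds r c → ∃ λ x → Move G r x × ¬ CanReach c x
    escape c r ¬w with Fin.¬∀⟶∃¬ order (λ x → Move G r x → CanReach c x) (λ x → move? G r x →-dec canReach? c x)
                         (λ f → ¬w (rounds-greatest (suc rounds) r c (inj₂ f)))
    ... | x , ¬f with move? G r x
    ...   | yes m = x , m , λ w → ¬f (λ _ → w)
    ...   | no ¬m = contradiction (λ m → contradiction m ¬m) ¬f

    flee : ∀ s → Safe s → ∃ λ x → Move G (proj₂ s) x × Safe (proj₂ s ∷ proj₁ s , x)
    flee (h , r) safe = escape (cop (r ∷ h)) r (λ w → safe (_ , legal r h zero , w))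

    module _ (r₀ : V) (safe₀ : Safe ([] , r₀)) where

      -- The play is built together with its history, since the cop's next placement depends on all
      -- of it.
      position : ℕ → Σ (List V × V) Safe
      position zero    = ([] , r₀) , safe₀
      position (suc t) = let s , safe = position t ; x , _ , safe′ = flee s safe in (proj₂ s ∷ proj₁ s , x) , safe′

      ρ : ℕ → V
      ρ = proj₂ ∘ proj₁ ∘ position

      ρ-play : RobberPlay G ρ
      ρ-play t = let s , safe = position t in proj₁ (proj₂ (flee s safe))

      ρ-history : ∀ t → history G ρ t ≡ proj₁ (proj₁ (position t))
      ρ-history zero    = refl
      ρ-history (suc t) = cong (ρ t ∷_) (ρ-history t)

      ρ-safe : ∀ t → ¬ CanReach (cop (history G ρ t)) (ρ t)
      ρ-safe t = subst (λ h → ¬ CanReach (cop h) (ρ t)) (sym (ρ-history t)) (proj₂ (position t))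

      ρ-escapes : ∀ t → ¬ CapturedAt G S ρ t
      -- Either kind of capture lets the cop stay on or move to `ρ t`, and a cop on the robber's
      -- vertex has won by stage 1.
      ρ-escapes t (zero , c) = ρ-safe t (ρ t ,
        [ inj₁ , (λ e → subst (Move G _) e (legal (ρ t) (history G ρ t) zero)) ]′ c ,
        rounds-greatest 1 (ρ t) (ρ t) (inj₁ refl))

  copWin⇒goodStart : CopWin 1 G → GoodStart
  copWin⇒goodStart (S , wins) = decidable-stable goodStart? λ ¬good →
    let r₀ , safe₀ = Fin.¬∀⟶∃¬ order (CanReach (cop S [])) (canReach? (cop S [])) (λ f → ¬good (_ , f))
        t , captured = wins (ρ S r₀ safe₀) (ρ-play S r₀ safe₀)
    in ρ-escapes S r₀ safe₀ t captured

point : Graph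
point = record
  { order      = 1
  ; adj        = λ _ _ → false
  ; adj-sym    = λ _ _ → refl
  ; adj-irrefl = λ _ → refl
  ; nonEmpty   = _
  ; connected  = λ { zero zero → ε }
  }

-- Arithmetic as logic, and lemmas on loops and lists

-- As in ifnz, the nonzero numbers represent truth.
data Truth (P : Set) : ℕ → Set where
  holds : ∀ {x} → P → Truth P (suc x)
  fails : ¬ P → Truth P 0

truth-map : ∀ {P Q x} → (P → Q) → (Q → P) → Truth P x → Truth Q x
truth-map f g (holds p) = holds (f p)
truth-map f g (fails ¬p) = fails (¬p ∘ g)

truth-≢0 : ∀ x → Truth (x ≢ 0) x
truth-≢0 zero    = fails λ z → z refl
truth-≢0 (suc x) = holds λ ()

truth⇒≢0 : ∀ {P x} → Truth P x → P → x ≢ 0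
truth⇒≢0 (fails ¬p) p _ = ¬p p

≢0⇒truth : ∀ {P x} → Truth P x → x ≢ 0 → P
≢0⇒truth (holds p)  _   = p
≢0⇒truth (fails ¬p) x≢0 = contradiction refl x≢0

truth-bit : ∀ b → Truth (T b) (if b then 1 else 0)
truth-bit true  = holds _
truth-bit false = fails λ ()

truth-not : ∀ {P x} → Truth P x → Truth (¬ P) (1 ∸ x)
truth-not {x = suc x} (holds p) = subst (Truth _) (sym (0∸n≡0 x)) (fails λ ¬p → ¬p p)
truth-not (fails ¬p)            = holds ¬p

truth-or : ∀ {P Q x y} → Truth P x → Truth Q y → Truth (P ⊎ Q) (x + y)
truth-or (holds p)  _          = holds (inj₁ p)
truth-or (fails ¬p) (holds q)  = holds (inj₂ q)
truth-or (fails ¬p) (fails ¬q) = fails [ ¬p , ¬q ]′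

-- De Morgan's law replaces the product, which the machine cannot form.
truth-and : ∀ {P Q x y} → Truth P x → Truth Q y → Truth (P × Q) (1 ∸ ((1 ∸ x) + (1 ∸ y)))
truth-and p q = truth-map (from p q) (λ (p , q) → [ (λ ¬p → ¬p p) , (λ ¬q → ¬q q) ]′)
  (truth-not (truth-or (truth-not p) (truth-not q)))
  where
  from : ∀ {P Q x y} → Truth P x → Truth Q y → ¬ (¬ P ⊎ ¬ Q) → P × Q
  from (holds p)  (holds q)  _ = p , q
  from (fails ¬p) _          n = contradiction (inj₁ ¬p) n
  from _          (fails ¬q) n = contradiction (inj₂ ¬q) n

truth-≡ : ∀ x y → Truth (x ≡ y) (1 ∸ ((x ∸ y) + (y ∸ x)))
truth-≡ zero    zero    = holds refl
truth-≡ zero    (suc y) = subst (Truth _) (sym (0∸n≡0 y)) (fails λ ())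
truth-≡ (suc x) zero    = subst (Truth _) (sym (0∸n≡0 (x + 0))) (fails λ ())
truth-≡ (suc x) (suc y) = truth-map (cong suc) suc-injective (truth-≡ x y)

truth-< : ∀ x y → Truth (x < y) (y ∸ x)
truth-< x       zero    = subst (Truth _) (sym (0∸n≡0 x)) (fails λ ())
truth-< zero    (suc y) = holds z<s
truth-< (suc x) (suc y) = truth-map s<s s<s⁻¹ (truth-< x y)

truth-any : ∀ {n} {P : Fin n → Set} (g : ℕ → ℕ) → (∀ a → Truth (P a) (g (toℕ a))) →
  Truth (∃ P) (sum (applyUpTo g n))
truth-any {zero}  g t = fails λ ()
truth-any {suc n} g t = truth-map
  [ (λ p → zero , p) , (λ (a , p) → suc a , p) ]′
  (λ { (zero , p) → inj₁ p ; (suc a , p) → inj₂ (a , p) })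
  (truth-or (t zero) (truth-any (g ∘ suc) (t ∘ suc)))

truth-all : ∀ {n} {P : Fin n → Set} (g : ℕ → ℕ) → (∀ a → Truth (P a) (g (toℕ a))) →
  Truth (∀ a → P a) (1 ∸ sum (applyUpTo (λ i → 1 ∸ g i) n))
truth-all {P = P} g t = truth-map
  (λ none a → ≢0⇒truth (t a) λ z → none (a , λ p → truth⇒≢0 (t a) p z))
  (λ f (a , ¬p) → ¬p (f a))
  (truth-not (truth-any (λ i → 1 ∸ g i) (λ a → truth-not (t a))))

-- Truth fixes a number only up to being nonzero. An outer negation makes it exactly 0 or 1, as
-- counting and printing require.
truth-does : ∀ {P} x (P? : Dec P) → Truth P (1 ∸ x) → 1 ∸ x ≡ (if does P? then 1 else 0)
truth-does zero    (yes p) _ = refl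
truth-does zero    (no ¬p) (holds p) = contradiction p ¬p
truth-does (suc x) (yes p) t = contradiction (0∸n≡0 x) (truth⇒≢0 t p)
truth-does (suc x) (no ¬p) _ = 0∸n≡0 x

sum-const : ∀ c n → sum (applyUpTo (const c) n) ≡ n * c
sum-const c zero    = refl
sum-const c (suc n) = cong (c +_) (sum-const c n)

sum-count : ∀ {A : Set} {P : A → Set} (P? : Decidable P) {n} (f : Fin n → A) (g : ℕ → ℕ) →
  (∀ a → Truth (P (f a)) (1 ∸ g (toℕ a))) →
  sum (applyUpTo (λ i → 1 ∸ g i) n) ≡ length (filter P? (tabulate f))
sum-count P? {zero}  f g t = refl
sum-count P? {suc n} f g t with P? (f zero) | truth-does (g 0) (P? (f zero)) (t zero)
... | yes _ | e = cong₂ _+_ e (sum-count P? (f ∘ suc) (g ∘ suc) (t ∘ suc))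
... | no _  | e = cong₂ _+_ e (sum-count P? (f ∘ suc) (g ∘ suc) (t ∘ suc))

concat-filter : ∀ {A B : Set} {P : A → Set} (P? : Decidable P) (g : A → List B) {n} (f : Fin n → A) →
  concat (tabulate (λ a → if does (P? (f a)) then g (f a) else [])) ≡ concatMap g (filter P? (tabulate f))
concat-filter P? g {zero}  f = refl
concat-filter P? g {suc n} f with P? (f zero)
... | yes _ = cong (g (f zero) ++_) (concat-filter P? g (f ∘ suc))
... | no _  = concat-filter P? g (f ∘ suc)

-- The round is an element of `Fin n`, so that in applications it can be read as a vertex.
loop-invariant : ∀ {S : Set} {n} (f : ℕ → S → S) (Inv : ℕ → S → Set) →
  (∀ (a : Fin n) s → Inv (toℕ a) s → Inv (suc (toℕ a)) (f (toℕ a) s)) → ∀ {s} → Inv 0 s → Inv n (loop f n s)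
loop-invariant {n = zero}  f Inv pres i = i
loop-invariant {n = suc n} f Inv pres i = loop-invariant (f ∘ suc) (Inv ∘ suc) (pres ∘ suc) (pres zero _ i)

loop-concat : ∀ {n} {A : Set} {ω : A} (f : ℕ → A × List ℕ → A × List ℕ) (g : Fin n → List ℕ) →
  (∀ a o → f (toℕ a) (ω , o) ≡ (ω , o ++ g a)) → ∀ o → loop f n (ω , o) ≡ (ω , o ++ concat (tabulate g))
loop-concat {zero}  f g e o = cong (_ ,_) (sym (++-identityʳ o))
loop-concat {suc n} f g e o = begin
  loop (f ∘ suc) n (f 0 (_ , o))                       ≡⟨ cong (loop (f ∘ suc) n) (e zero o) ⟩
  loop (f ∘ suc) n (_ , o ++ g zero)                   ≡⟨ loop-concat (f ∘ suc) (g ∘ suc) (e ∘ suc) _ ⟩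
  _ , (o ++ g zero) ++ concat (tabulate (g ∘ suc))     ≡⟨ cong (_ ,_) (++-assoc o _ _) ⟩
  _ , o ++ g zero ++ concat (tabulate (g ∘ suc))       ∎
  where open ≡-Reasoning

nth-++ˡ : ∀ xs ys {j} → j < length xs → nth (xs ++ ys) j ≡ nth xs j
nth-++ˡ (x ∷ xs) ys {zero}  _ = refl
nth-++ˡ (x ∷ xs) ys {suc j} l = nth-++ˡ xs ys (s<s⁻¹ l)

nth-++ʳ : ∀ xs ys j → nth (xs ++ ys) (length xs + j) ≡ nth ys j
nth-++ʳ []       ys j = refl
nth-++ʳ (x ∷ xs) ys j = nth-++ʳ xs ys j

nth-tabulate : ∀ {n} (f : Fin n → ℕ) a → nth (tabulate f) (toℕ a) ≡ f a
nth-tabulate f zero    = refl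
nth-tabulate f (suc a) = nth-tabulate (f ∘ suc) a

nth-concat : ∀ {m n} (rows : Fin m → List ℕ) → (∀ u → length (rows u) ≡ n) →
  ∀ u {j} → j < n → nth (concat (tabulate rows)) (n * toℕ u + j) ≡ nth (rows u) j
nth-concat {n = n} rows len zero {j} j<n = begin
  nth (concat (tabulate rows)) (n * 0 + j)  ≡⟨ cong (λ z → nth (concat (tabulate rows)) (z + j)) (*-zeroʳ n) ⟩
  nth (rows zero ++ _) j                    ≡⟨ nth-++ˡ (rows zero) _ (subst (j <_) (sym (len zero)) j<n) ⟩
  nth (rows zero) j                         ∎
  where open ≡-Reasoning
nth-concat {n = n} rows len (suc u) {j} j<n = begin
  nth (concat (tabulate rows)) (n * suc (toℕ u) + j)      ≡⟨ cong (nth (concat (tabulate rows))) shift ⟩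
  nth (rows zero ++ _) (length (rows zero) + (n * toℕ u + j)) ≡⟨ nth-++ʳ (rows zero) _ _ ⟩
  nth (concat (tabulate (rows ∘ suc))) (n * toℕ u + j)    ≡⟨ nth-concat (rows ∘ suc) (len ∘ suc) u j<n ⟩
  nth (rows (suc u)) j                                    ∎
  where
  open ≡-Reasoning
  shift : n * suc (toℕ u) + j ≡ length (rows zero) + (n * toℕ u + j)
  shift = trans (cong (_+ j) (*-suc n (toℕ u))) (trans (+-assoc n _ j) (cong (_+ _) (sym (len zero))))

-- The kernelization as a command

pattern 0F = zero
pattern 1F = suc zero

not : ∀ {v} → Term v → Term v
not e = lit 1 ⊖ e

_∧_ : ∀ {v} → Term v → Term v → Term v
d ∧ e = not (not d ⊕ not e)

_≐_ : ∀ {v} → Term v → Term v → Term v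
d ≐ e = not ((d ⊖ e) ⊕ (e ⊖ d))

all : ∀ {v} → Term (suc v) → Term v
all e = not (∑ (not e))

-- The sum multiplies x by the number of vertices; the matrix starts in cell 2.
index : ∀ {v} → Fin v → Fin v → Term v
index x y = ∑ (var (suc x)) ⊕ var y

edge : ∀ {v} → Fin v → Fin v → Term v
edge x y = input (lit 2 ⊕ index x y)

near : ∀ {v} → Fin v → Fin v → Term v
near x y = (var x ≐ var y) ⊕ edge x y

twin : ∀ {v} → Fin v → Fin v → Term v
twin x y = all ((var 0F ≐ var (suc x)) ⊕ ((var 0F ≐ var (suc y)) ⊕ (edge (suc x) 0F ≐ edge (suc y) 0F)))

reaches : ∀ {v} → Fin v → Fin v → Term v
reaches c r = ∑ (near (suc c) 0F ∧ work (index (suc r) 0F))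

least : ∀ {v} → Fin v → Term v
least x = not (∑ ((var (suc x) ⊖ var 0F) ∧ twin 0F (suc x)))

attack : ∀ {v} → Fin v → Fin v → Term v
attack r c = (var r ≐ var c) ⊕ all (not (near (suc r) 0F) ⊕ reaches (suc c) 0F)

attackRound : ∀ {v} → Command v
attackRound = for (for (store (index 1F 0F) (attack 1F 0F)))

cops : Term 0
cops = input (lit 1)

classes : Term 0
classes = ∑ (least 0F)

-- cops ⊖ (cops ⊖ classes) is a minimum, by truncated subtraction.
reduce decide kernelCommand : Command 0
reduce = print classes ⨾ print (cops ⊖ (cops ⊖ classes)) ⨾
  for (ifnz (least 0F) (for (ifnz (least 0F) (print (edge 1F 0F)) skip)) skip)
decide = for (for attackRound) ⨾
  print (lit 1) ⨾ print (not (not (∑ (all (reaches 1F 0F))))) ⨾ print (lit 0)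
kernelCommand = ifnz ((cops ⊖ lit 1) ⊕ (lit 1 ⊖ cops)) reduce decide

bit : Bool → ℕ
bit b = if b then 1 else 0

-- Correctness of the command

module Correct (G : Graph) (k : ℕ) where
  open Graph G

  private
    n = order

  α : Array
  α = nth (encodeCR (record { graph = G ; k = k }))

  infix 4 _at_≡_
  _at_≡_ : ∀ {v} → Vec ℕ v → Fin v → V → Set
  ρ at x ≡ u = lookup ρ x ≡ toℕ u

  cell : V → V → ℕ
  cell u v = n * toℕ u + toℕ v

  input-cell : ∀ u v → α (2 + cell u v) ≡ bit (adj u v)
  input-cell u v = begin
    nth (concatMap row (allFin n)) (cell u v)    ≡⟨ cong (λ rs → nth (concat rs) (cell u v)) (map-tabulate id row) ⟩
    nth (concat (tabulate row)) (cell u v)       ≡⟨ nth-concat row row-length u (Fin.toℕ<n v) ⟩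
    nth (row u) (toℕ v)                          ≡⟨ cong (λ r → nth r (toℕ v)) (map-tabulate id (bit ∘ adj u)) ⟩
    nth (tabulate (bit ∘ adj u)) (toℕ v)         ≡⟨ nth-tabulate (bit ∘ adj u) v ⟩
    bit (adj u v)                                ∎
    where
    open ≡-Reasoning
    row : V → List ℕ
    row u = map (λ v → bit (adj u v)) (allFin n)
    row-length : ∀ u → length (row u) ≡ n
    row-length u = trans (cong length (map-tabulate id (bit ∘ adj u))) (length-tabulate (bit ∘ adj u))

  at-each : ∀ {v} → Term (suc v) → Array → Vec ℕ v → ℕ → ℕ
  at-each e ω ρ i = ⟦ e ⟧ α ω (i ∷ ρ)

  module _ {v} (ω : Array) (ρ : Vec ℕ v) where

    index-value : ∀ x y {a b} → ρ at x ≡ a → ρ at y ≡ b → ⟦ index x y ⟧ α ω ρ ≡ cell a b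
    index-value x y ea eb = cong₂ _+_ (trans (sum-const _ n) (cong (n *_) ea)) eb

    edge-value : ∀ x y {a b} → ρ at x ≡ a → ρ at y ≡ b → ⟦ edge x y ⟧ α ω ρ ≡ bit (adj a b)
    edge-value x y ea eb = trans (cong (α ∘ (2 +_)) (index-value x y ea eb)) (input-cell _ _)

    equal-truth : ∀ x y {a b} → ρ at x ≡ a → ρ at y ≡ b → Truth (a ≡ b) (⟦ var x ≐ var y ⟧ α ω ρ)
    equal-truth x y ea eb = truth-map
      (λ e → Fin.toℕ-injective (trans (sym ea) (trans e eb)))
      (λ e → trans ea (trans (cong toℕ e) (sym eb)))
      (truth-≡ (lookup ρ x) (lookup ρ y))

    near-truth : ∀ x y {a b} → ρ at x ≡ a → ρ at y ≡ b → Truth (Move G a b) (⟦ near x y ⟧ α ω ρ)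
    near-truth x y {a} {b} ea eb = truth-or (equal-truth x y ea eb)
      (subst (Truth (Adj a b)) (sym (edge-value x y ea eb)) (truth-bit (adj a b)))

  twin-truth : ∀ {v} ω (ρ : Vec ℕ v) x y {a b} → ρ at x ≡ a → ρ at y ≡ b → Truth (Twins G a b) (⟦ twin x y ⟧ α ω ρ)
  twin-truth ω ρ x y {a} {b} ea eb = truth-map
    (λ f z z≢a z≢b → [ (λ e → contradiction e z≢a) , [ (λ e → contradiction e z≢b) , id ]′ ]′ (f z))
    from
    (truth-all (at-each ((var 0F ≐ var (suc x)) ⊕ ((var 0F ≐ var (suc y)) ⊕ (edge (suc x) 0F ≐ edge (suc y) 0F))) ω ρ) λ z →
      truth-or (equal-truth ω (toℕ z ∷ ρ) 0F (suc x) refl ea)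
        (truth-or (equal-truth ω (toℕ z ∷ ρ) 0F (suc y) refl eb) (edges z)))
    where
    bit-injective : ∀ {b c} → bit b ≡ bit c → b ≡ c
    bit-injective {true}  {true}  _ = refl
    bit-injective {false} {false} _ = refl

    edges : ∀ z → Truth (adj a z ≡ adj b z) (⟦ edge (suc x) 0F ≐ edge (suc y) 0F ⟧ α ω (toℕ z ∷ ρ))
    edges z = truth-map
      (λ e → bit-injective (trans (sym ax) (trans e by)))
      (λ e → trans ax (trans (cong bit e) (sym by)))
      (truth-≡ (⟦ edge (suc x) 0F ⟧ α ω (toℕ z ∷ ρ)) (⟦ edge (suc y) 0F ⟧ α ω (toℕ z ∷ ρ)))
      where
      ax = edge-value ω (toℕ z ∷ ρ) (suc x) 0F {a} {z} ea refl
      by = edge-value ω (toℕ z ∷ ρ) (suc y) 0F {b} {z} eb refl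

    from : Twins G a b → ∀ z → z ≡ a ⊎ z ≡ b ⊎ adj a z ≡ adj b z
    from t z with z Fin.≟ a | z Fin.≟ b
    ... | yes e | _     = inj₁ e
    ... | no _  | yes e = inj₂ (inj₁ e)
    ... | no ≢a | no ≢b = inj₂ (inj₂ (t z ≢a ≢b))

  open Quotient G
  open OneCop G

  least-truth : ∀ {v} ω (ρ : Vec ℕ v) x {a} → ρ at x ≡ a → Truth (IsLeast a) (⟦ least x ⟧ α ω ρ)
  least-truth ω ρ x {a} ea =
    truth-not (truth-any (at-each ((var (suc x) ⊖ var 0F) ∧ twin 0F (suc x)) ω ρ) λ z → truth-and
      (subst (λ w → Truth (toℕ z < toℕ a) (w ∸ toℕ z)) (sym ea) (truth-< (toℕ z) (toℕ a)))
      (twin-truth ω (toℕ z ∷ ρ) 0F (suc x) refl ea))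

  Marked : Array → V → V → Set
  Marked ω r c = ω (cell r c) ≢ 0

  reaches-truth : ∀ {v} ω (ρ : Vec ℕ v) c r {a b} → ρ at c ≡ a → ρ at r ≡ b →
    Truth (Reaches (Marked ω) a b) (⟦ reaches c r ⟧ α ω ρ)
  reaches-truth ω ρ c r {a} {b} ea eb =
    truth-any (at-each (near (suc c) 0F ∧ work (index (suc r) 0F)) ω ρ) λ z → truth-and
      (near-truth ω (toℕ z ∷ ρ) (suc c) 0F ea refl)
      (subst (λ i → Truth (Marked ω b z) (ω i)) (sym (index-value ω (toℕ z ∷ ρ) (suc r) 0F eb refl)) (truth-≢0 _))

  attack-truth : ∀ {v} ω (ρ : Vec ℕ v) r c {a b} → ρ at r ≡ a → ρ at c ≡ b →
    Truth (Attack (Marked ω) a b) (⟦ attack r c ⟧ α ω ρ)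
  attack-truth ω ρ r c {a} {b} ea eb = truth-or (equal-truth ω ρ r c ea eb)
    (truth-all (at-each (not (near (suc r) 0F) ⊕ reaches (suc c) 0F) ω ρ) λ z →
      truth-map (λ o m → [ contradiction m , id ]′ o) (into z)
        (truth-or (truth-not (near-truth ω (toℕ z ∷ ρ) (suc r) 0F ea refl))
                  (reaches-truth ω (toℕ z ∷ ρ) (suc c) 0F eb refl)))
    where
    into : ∀ z → (Move G a z → Reaches (Marked ω) b z) → ¬ Move G a z ⊎ Reaches (Marked ω) b z
    into z f with move? G a z
    ... | yes m = inj₂ (f m)
    ... | no ¬m = inj₁ ¬m

  private
    run : ∀ {v} → Command v → Vec ℕ v → Array × List ℕ → Array × List ℕ
    run = exec α

  -- Quantifying over the work array and the earlier output makes such commands compose by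
  -- concatenation.
  record Prints {v} (c : Command v) (ρ : Vec ℕ v) (xs : List ℕ) : Set where
    constructor prints
    field
      printing : ∀ ω o → run c ρ (ω , o) ≡ (ω , o ++ xs)
  open Prints

  prints-term : ∀ {v} {e : Term v} {ρ x} → (∀ ω → ⟦ e ⟧ α ω ρ ≡ x) → Prints (print e) ρ [ x ]
  prints-term e = prints λ ω o → cong (λ x → ω , o ++ [ x ]) (e ω)

  prints-seq : ∀ {v} {c d : Command v} {ρ xs ys} → Prints c ρ xs → Prints d ρ ys → Prints (c ⨾ d) ρ (xs ++ ys)
  prints-seq {d = d} {ρ} (prints p) (prints q) = prints λ ω o →
    trans (cong (run d ρ) (p ω o)) (trans (q ω _) (cong (ω ,_) (++-assoc o _ _)))

  prints-for : ∀ {v} {c : Command (suc v)} {ρ} {g : V → List ℕ} →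
    (∀ a → Prints c (toℕ a ∷ ρ) (g a)) → Prints (for c) ρ (concat (tabulate g))
  prints-for p = prints λ ω → loop-concat _ _ (λ a → printing (p a) ω)

  prints-when : ∀ {v} {e : Term v} {c ρ xs} {P : Set} (P? : Dec P) →
    (∀ ω → Truth P (⟦ e ⟧ α ω ρ)) → Prints c ρ xs → Prints (ifnz e c skip) ρ (if does P? then xs else [])
  prints-when {e = e} {c} {ρ} {xs} P? t (prints p) = prints λ ω o → choose (⟦ e ⟧ α ω ρ) (t ω) P? ω o
    where
    choose : ∀ x {P} → Truth P x → (P? : Dec P) → ∀ ω o →
      branch x (run c ρ (ω , o)) (ω , o) ≡ (ω , o ++ (if does P? then xs else []))
    choose _ (holds _)  (yes _) ω o = p ω o
    choose _ (fails _)  (no _)  ω o = cong (ω ,_) (sym (++-identityʳ o))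
    choose _ (holds p)  (no ¬p) ω o = contradiction p ¬p
    choose _ (fails ¬p) (yes p) ω o = contradiction p ¬p

  quotientInstance : CRInstance
  quotientInstance = record { graph = quotient ; k = k ⊓ length representatives }

  private
    m = length representatives

  classes-value : ∀ ω → ⟦ classes ⟧ α ω [] ≡ m
  classes-value ω = sum-count isLeast? id (at-each (∑ ((var 1F ⊖ var 0F) ∧ twin 0F 1F)) ω [])
    λ a → least-truth ω (toℕ a ∷ []) 0F refl

  ⊓-as-∸ : ∀ i j → i ∸ (i ∸ j) ≡ i ⊓ j
  ⊓-as-∸ i j with ≤-total i j
  ... | inj₁ i≤j = trans (cong (i ∸_) (m≤n⇒m∸n≡0 i≤j)) (sym (m≤n⇒m⊓n≡m i≤j))
  ... | inj₂ j≤i = trans (m∸[m∸n]≡n j≤i) (sym (m≥n⇒m⊓n≡n j≤i))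

  -- The nested loops run through all vertices in increasing order and skip those that are not
  -- least; `embed` lists the representatives in the same order.
  matrix-code : concat (tabulate λ u → if does (isLeast? u)
                  then concat (tabulate λ v → if does (isLeast? v) then [ bit (adj u v) ] else []) else [])
    ≡ concatMap (λ i → map (λ j → bit (adj (embed i) (embed j))) (allFin m)) (allFin m)
  matrix-code = begin
    concat (tabulate λ u → if does (isLeast? u) then _ else [])
      ≡⟨ concat-filter isLeast? (λ u → concat (tabulate λ v → if does (isLeast? v) then [ bit (adj u v) ] else [])) id ⟩
    concatMap (λ u → concat (tabulate λ v → if does (isLeast? v) then [ bit (adj u v) ] else [])) representatives
      ≡⟨ concatMap-cong row representatives ⟩
    concatMap (λ u → map (bit ∘ adj u ∘ embed) (allFin m)) representatives
      ≡⟨ cong (concatMap _) reps ⟨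
    concatMap (λ u → map (bit ∘ adj u ∘ embed) (allFin m)) (map embed (allFin m))
      ≡⟨ concatMap-map _ embed (allFin m) ⟩
    concatMap (λ i → map (λ j → bit (adj (embed i) (embed j))) (allFin m)) (allFin m) ∎
    where
    open ≡-Reasoning
    reps : map embed (allFin m) ≡ representatives
    reps = trans (map-tabulate id embed) (tabulate-lookup representatives)
    row : ∀ u → concat (tabulate λ v → if does (isLeast? v) then [ bit (adj u v) ] else [])
      ≡ map (bit ∘ adj u ∘ embed) (allFin m)
    row u = begin
      concat (tabulate λ v → if does (isLeast? v) then [ bit (adj u v) ] else [])
        ≡⟨ concat-filter isLeast? (λ v → [ bit (adj u v) ]) id ⟩
      concatMap ([_] ∘ bit ∘ adj u) representatives
        ≡⟨ concatMap-map [_] (bit ∘ adj u) representatives ⟨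
      concatMap [_] (map (bit ∘ adj u) representatives)
        ≡⟨ concat-map-[ map (bit ∘ adj u) representatives ] ⟩
      map (bit ∘ adj u) representatives
        ≡⟨ cong (map _) reps ⟨
      map (bit ∘ adj u) (map embed (allFin m))
        ≡⟨ map-∘ (allFin m) ⟨
      map (bit ∘ adj u ∘ embed) (allFin m) ∎

  reduce-prints : Prints reduce [] (encodeCR quotientInstance)
  reduce-prints = subst (λ xs → Prints reduce [] (m ∷ k ⊓ m ∷ xs)) matrix-code
    (prints-seq (prints-term classes-value) (prints-seq
      (prints-term λ ω → trans (cong (λ c → k ∸ (k ∸ c)) (classes-value ω)) (⊓-as-∸ k m))
      (prints-for λ u → prints-when (isLeast? u) (λ ω → least-truth ω (toℕ u ∷ []) 0F refl)
        (prints-for λ v → prints-when (isLeast? v) (λ ω → least-truth ω (toℕ v ∷ toℕ u ∷ []) 0F refl)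
          (prints-term λ ω → edge-value ω (toℕ v ∷ toℕ u ∷ []) 1F 0F refl refl)))))

  -- The work array is updated in place, so while stage suc t is computed from
  -- stage t the marks may run ahead; they never leave the final stage.
  record Progress (t : ℕ) (F : V → V → Set) (s : Array × List ℕ) : Set where
    constructor progress
    field
      silent   : proj₂ s ≡ []
      sound    : ∀ r c → Marked (proj₁ s) r c → Stage rounds r c
      reached  : ∀ r c → Stage t r c → Marked (proj₁ s) r c
      advanced : ∀ r c → F r c → Stage (suc t) r c → Marked (proj₁ s) r c

  weaken : ∀ {t F F′ s} → (∀ r c → F′ r c → F r c) → Progress t F s → Progress t F′ s
  weaken i (progress o s r a) = progress o s r λ x y f → a x y (i x y f)

  mark-progress : ∀ {v} {ρ : Vec ℕ v} {t F s} r c → Progress t F s →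
    Progress t (λ r′ c′ → F r′ c′ ⊎ (r′ ≡ r × c′ ≡ c)) (run (store (index 1F 0F) (attack 1F 0F)) (toℕ c ∷ toℕ r ∷ ρ) s)
  mark-progress {v} {ρ} {t} {F} {ω , o} r c (progress silent sound reached advanced) = progress silent
    sound′
    -- Overwriting could erase a mark, but a position of stage `t` is also in stage `suc t`, so its
    -- recomputed value is nonzero again.
    (λ r′ c′ w → keep r′ c′ (reached r′ c′ w) (⊑-suc t r′ c′ w))
    (λ r′ c′ f w → [ (λ f → keep r′ c′ (advanced r′ c′ f w) w) , (λ { (refl , refl) → now w }) ]′ f)
    where
    here : ℕ
    here = ⟦ index 1F 0F ⟧ α ω (toℕ c ∷ toℕ r ∷ ρ)

    value : ℕ
    value = ⟦ attack 1F 0F ⟧ α ω (toℕ c ∷ toℕ r ∷ ρ)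

    here≡ : here ≡ cell r c
    here≡ = index-value ω (toℕ c ∷ toℕ r ∷ ρ) 1F 0F refl refl

    ω′ : Array
    ω′ j = if here ≡ᵇ j then value else ω j

    same : ω′ (cell r c) ≡ value
    -- The work array is viewed as array 2 of a constant memory, which makes the lemmas on `update`
    -- applicable.
    same = trans (cong (λ i → update (λ _ → ω) 2 i value 2 (cell r c)) here≡) (update-same (λ _ → ω) 2 (cell r c) value)

    other : ∀ {r′ c′} → ¬ (r′ ≡ r × c′ ≡ c) → ω′ (cell r′ c′) ≡ ω (cell r′ c′)
    other {r′} {c′} ≢ = update-other (λ _ → ω) 2 here value 2 (cell r′ c′) λ (_ , e) → ≢
      (Fin.combine-injective r′ c′ r c
      (Fin.toℕ-injective (trans (Fin.toℕ-combine r′ c′) (trans (sym e) (trans here≡ (sym (Fin.toℕ-combine r c)))))))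

    truth : Truth (Attack (Marked ω) r c) value
    truth = attack-truth ω (toℕ c ∷ toℕ r ∷ ρ) 1F 0F refl refl

    case : ∀ {P : V → V → Set} → P r c → (∀ r′ c′ → ¬ (r′ ≡ r × c′ ≡ c) → P r′ c′) → ∀ r′ c′ → P r′ c′
    case p q r′ c′ with r′ Fin.≟ r | c′ Fin.≟ c
    ... | yes refl | yes refl = p
    ... | no ≢     | _        = q r′ c′ (≢ ∘ proj₁)
    ... | yes _    | no ≢     = q r′ c′ (≢ ∘ proj₂)

    now : Stage (suc t) r c → Marked ω′ r c
    now w = subst (_≢ 0) (sym same) (truth⇒≢0 truth (attack-mono reached r c w))

    sound′ : ∀ r′ c′ → Marked ω′ r′ c′ → Stage rounds r′ c′
    sound′ = case
      -- A new mark is an attack on old marks, all of which lie in stage `rounds`, and that stage is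
      -- closed under `Attack`.
      (λ marked → rounds-greatest (suc rounds) r c
        (attack-mono sound r c (≢0⇒truth truth (subst (_≢ 0) same marked))))
      (λ r′ c′ ≢ marked → sound r′ c′ (subst (_≢ 0) (other ≢) marked))

    keep : ∀ r′ c′ → Marked ω r′ c′ → Stage (suc t) r′ c′ → Marked ω′ r′ c′
    keep = case (λ _ → now) (λ r′ c′ ≢ marked _ → subst (_≢ 0) (sym (other ≢)) marked)

  Settled : ℕ → Array × List ℕ → Set
  Settled t = Progress t (λ _ _ → ⊥)

  -- The set `F` of cells already treated grows in row-major order; once it is everything,
  -- `advanced` becomes `reached` for the next stage.
  attackRound-settled : ∀ {v} (ρ : Vec ℕ v) t s → Settled t s → Settled (suc t) (run attackRound ρ s)
  attackRound-settled ρ t s p = finish (loop-invariant _ (λ i → Progress t (λ r _ → toℕ r < i)) row (weaken (λ _ _ ()) p))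
    where
    finish : ∀ {s} → Progress t (λ r _ → toℕ r < n) s → Settled (suc t) s
    finish (progress o s _ a) = progress o s (λ r c → a r c (Fin.toℕ<n r)) (λ _ _ ())

    row : ∀ r s → Progress t (λ r′ _ → toℕ r′ < toℕ r) s →
      Progress t (λ r′ _ → toℕ r′ < suc (toℕ r)) (run (for (store (index 1F 0F) (attack 1F 0F))) (toℕ r ∷ ρ) s)
    row r s p = weaken into (loop-invariant _
      (λ j → Progress t (λ r′ c′ → toℕ r′ < toℕ r ⊎ (r′ ≡ r × toℕ c′ < j)))
      (λ c s q → weaken (split c) (mark-progress {ρ = ρ} r c q))
      (weaken (λ { _ _ (inj₁ l) → l ; _ _ (inj₂ ()) }) p))
      where
      into : ∀ r′ c′ → toℕ r′ < suc (toℕ r) → toℕ r′ < toℕ r ⊎ (r′ ≡ r × toℕ c′ < n)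
      into r′ c′ l with m≤n⇒m<n∨m≡n (s≤s⁻¹ l)
      ... | inj₁ r′<r = inj₁ r′<r
      ... | inj₂ e    = inj₂ (Fin.toℕ-injective e , Fin.toℕ<n c′)
      split : ∀ c r′ c′ → toℕ r′ < toℕ r ⊎ (r′ ≡ r × toℕ c′ < suc (toℕ c)) →
        (toℕ r′ < toℕ r ⊎ (r′ ≡ r × toℕ c′ < toℕ c)) ⊎ (r′ ≡ r × c′ ≡ c)
      split c r′ c′ (inj₁ l) = inj₁ (inj₁ l)
      split c r′ c′ (inj₂ (e , l)) with m≤n⇒m<n∨m≡n (s≤s⁻¹ l)
      ... | inj₁ l′ = inj₁ (inj₂ (e , l′))
      ... | inj₂ e′ = inj₂ (e , Fin.toℕ-injective e′)

  -- Two nested loops give `order * order` rounds, which is `rounds`. The zeros of the fresh work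
  -- array mark stage 0, which is empty.
  attack-settled : Settled rounds (run (for (for attackRound)) [] ((λ _ → 0) , []))
  attack-settled = loop-invariant {n = n} (λ i → run (for attackRound) (i ∷ [])) (λ i → Settled (i * n))
    (λ i s → loop-invariant {n = n} (λ j → run attackRound (j ∷ toℕ i ∷ [])) (λ j → Settled (j + toℕ i * n))
      (λ j s → attackRound-settled (toℕ j ∷ toℕ i ∷ []) (toℕ j + toℕ i * n) s))
    (progress refl (λ _ _ z → contradiction refl z) (λ _ _ ()) (λ _ _ ()))

  decidedInstance : CRInstance
  decidedInstance = record { graph = point ; k = if does goodStart? then 1 else 0 }

  goodStart-truth : ∀ {s} → Settled rounds s → Truth GoodStart (⟦ ∑ (all (reaches 1F 0F)) ⟧ α (proj₁ s) [])
  goodStart-truth {ω , _} (progress _ sound reached _) = truth-map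
    (λ (c , f) → c , λ r → map₂ (λ {y} → map₂ (sound r y)) (f r))
    (λ (c , f) → c , λ r → map₂ (λ {y} → map₂ (reached r y)) (f r))
    (truth-any (at-each (all (reaches 1F 0F)) ω []) λ c →
      truth-all (at-each (reaches 1F 0F) ω (toℕ c ∷ [])) λ r →
        reaches-truth ω (toℕ r ∷ toℕ c ∷ []) 1F 0F refl refl)

  -- The output is the order 1, the number of cops and the only matrix entry 0. The double negation
  -- in `decide` turns a count into a bit.
  decide-result : proj₂ (run decide [] ((λ _ → 0) , [])) ≡ encodeCR decidedInstance
  decide-result = cong₂ (λ o b → ((o ++ [ 1 ]) ++ [ b ]) ++ [ 0 ]) (Progress.silent attack-settled)
    (truth-does (1 ∸ ⟦ ∑ (all (reaches 1F 0F)) ⟧ α (proj₁ (run (for (for attackRound)) [] ((λ _ → 0) , []))) [])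
      goodStart? (truth-map (decidable-stable goodStart?) (λ g ¬g → ¬g g)
      (truth-not (truth-not (goodStart-truth attack-settled)))))

-- The kernel: equivalence and number of vertices

kernel : CRInstance → CRInstance
kernel record { graph = G ; k = 1 } = Correct.decidedInstance G 1
kernel record { graph = G ; k = k } = Correct.quotientInstance G k

kernelCommand-result : ∀ I → result kernelCommand (encodeCR I) ≡ encodeCR (kernel I)
kernelCommand-result record { graph = G ; k = 0 } =
  cong proj₂ (Correct.Prints.printing (Correct.reduce-prints G 0) (λ _ → 0) [])
kernelCommand-result record { graph = G ; k = 1 } = Correct.decide-result G 1
kernelCommand-result record { graph = G ; k = suc (suc k) } =
  cong proj₂ (Correct.Prints.printing (Correct.reduce-prints G (2 + k)) (λ _ → 0) [])

quotient-equivalent : ∀ G k → k ≢ 1 → CopWin k G ⇔ CopWin (k ⊓ length (Quotient.representatives G)) (Quotient.quotient G)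
quotient-equivalent G k k≢1 = copWin-⊓ k ⇔-∘ copWin-quotient G k k≢1

decided-equivalent : ∀ G → CopWin 1 G ⇔ CopWin (if does (OneCop.goodStart? G) then 1 else 0) point
decided-equivalent G with OneCop.goodStart? G
... | yes good = mk⇔ (λ _ → copWin-cover ≤-refl) (λ _ → OneCop.goodStart⇒copWin G good)
... | no ¬good = mk⇔ (λ w → contradiction (OneCop.copWin⇒goodStart G w) ¬good) (λ w → contradiction w no-copWin-zero)

kernel-equivalent : ∀ I → CopWin (CRInstance.k I) (CRInstance.graph I) ⇔
  CopWin (CRInstance.k (kernel I)) (CRInstance.graph (kernel I))
kernel-equivalent record { graph = G ; k = 0 }           = quotient-equivalent G 0 λ ()
kernel-equivalent record { graph = G ; k = 1 }           = decided-equivalent G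
kernel-equivalent record { graph = G ; k = suc (suc k) } = quotient-equivalent G (2 + k) λ ()

kernelOrder kernelCops : CRInstance → ℕ
kernelOrder I = Graph.order (CRInstance.graph (kernel I))
kernelCops I = CRInstance.k (kernel I)

kernelOrder≤nd : ∀ I → kernelOrder I ≤ nd (CRInstance.graph I)
kernelOrder≤nd record { graph = G ; k = 0 }           = Quotient.order≤nd G
-- The single vertex fits because the quotient is nonempty, so `nd` is at least 1.
kernelOrder≤nd record { graph = G ; k = 1 }           = ≤-trans
  (>-nonZero⁻¹ _ {{Graph.nonEmpty (Quotient.quotient G)}}) (Quotient.order≤nd G)
kernelOrder≤nd record { graph = G ; k = suc (suc k) } = Quotient.order≤nd G

kernelCops≤order : ∀ I → kernelCops I ≤ kernelOrder I
kernelCops≤order record { graph = G ; k = 0 }           = z≤n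
kernelCops≤order record { graph = G ; k = 1 } with does (OneCop.goodStart? G)
... | true  = ≤-refl
... | false = z≤n
kernelCops≤order record { graph = G ; k = suc (suc k) } = m⊓n≤n (2 + k) _

-- The size of encodings

n≤2^n : ∀ n → n ≤ 2 ^ n
n≤2^n zero    = z≤n
n≤2^n (suc n) = ≤-trans (s≤s (n≤2^n n)) (+-mono-≤ (m^n>0 2 n) (m≤m+n (2 ^ n) 0))

⌊log₂n⌋≤n : ∀ n → ⌊log₂ n ⌋ ≤ n
⌊log₂n⌋≤n n = ≤-trans (⌊log₂⌋-mono-≤ (n≤2^n n)) (≤-reflexive (⌊log₂[2^n]⌋≡n n))

size-++ : ∀ xs ys → size (xs ++ ys) ≡ size xs + size ys
size-++ xs ys = trans (cong sum (map-++ _ xs ys)) (sum-++ (map _ xs) (map _ ys))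

size-concatMap-≤ : ∀ {A : Set} (g : A → List ℕ) b → (∀ x → size (g x) ≤ b) →
  ∀ xs → size (concatMap g xs) ≤ length xs * b
size-concatMap-≤ g b le []       = z≤n
size-concatMap-≤ g b le (x ∷ xs) =
  ≤-trans (≤-reflexive (size-++ (g x) _)) (+-mono-≤ (le x) (size-concatMap-≤ g b le xs))

length≤size : ∀ xs → length xs ≤ size xs
length≤size []       = z≤n
length≤size (x ∷ xs) = +-mono-≤ (s≤s z≤n) (length≤size xs)

length-concatMap-≥ : ∀ {A : Set} (g : A → List ℕ) → (∀ x → 1 ≤ length (g x)) →
  ∀ xs → length xs ≤ length (concatMap g xs)
length-concatMap-≥ g le []       = z≤n
length-concatMap-≥ g le (x ∷ xs) =
  ≤-trans (+-mono-≤ (le x) (length-concatMap-≥ g le xs)) (≤-reflexive (sym (length-++ (g x))))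

size-bits : ∀ {A : Set} (b : A → Bool) xs → size (map (bit ∘ b) xs) ≡ length xs
size-bits b [] = refl
size-bits b (x ∷ xs) with b x
... | true  = cong suc (size-bits b xs)
... | false = cong suc (size-bits b xs)

length-allFin : ∀ n → length (allFin n) ≡ n
length-allFin n = length-tabulate id

-- At most `p * p` matrix entries of one digit, and at most `p + 1` digits for each of the two
-- leading numbers. Bounding logarithms by their arguments keeps the function within sums.
sizeBound : ℕ → ℕ
sizeBound p = p * p + (p + p + 2)

size-encodeCR : ∀ I {p} → Graph.order (CRInstance.graph I) ≤ p → CRInstance.k I ≤ p → size (encodeCR I) ≤ sizeBound p
size-encodeCR record { graph = G ; k = k } {p} n≤p k≤p = begin
  suc ⌊log₂ order ⌋ + (suc ⌊log₂ k ⌋ + size bits)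
    ≤⟨ +-mono-≤ (s≤s (≤-trans (⌊log₂n⌋≤n order) n≤p)) (+-mono-≤ (s≤s (≤-trans (⌊log₂n⌋≤n k) k≤p)) bits≤) ⟩
  suc p + (suc p + p * p)
    ≡⟨ solve 2 (λ x y → (con 1 :+ x) :+ ((con 1 :+ x) :+ y) := y :+ (x :+ x :+ con 2)) refl p (p * p) ⟩
  p * p + (p + p + 2)     ∎
  where
  open Graph G
  open ≤-Reasoning
  open +-*-Solver
  row : V → List ℕ
  row u = map (λ v → bit (adj u v)) (allFin order)
  bits : List ℕ
  bits = concatMap row (allFin order)
  bits≤ : size bits ≤ p * p
  bits≤ = ≤-trans
    (size-concatMap-≤ row order
      (λ u → ≤-reflexive (trans (size-bits (adj u) (allFin order)) (length-allFin order))) (allFin order))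
    (*-mono-≤ (≤-trans (≤-reflexive (length-allFin order)) n≤p) n≤p)

-- Strict, so that the base `suc n` of the polynomial bounds may be replaced by the input size.
order<size-encodeCR : ∀ I → Graph.order (CRInstance.graph I) < size (encodeCR I)
order<size-encodeCR record { graph = G ; k = k } = ≤-trans (s≤s (m≤n⇒m≤1+n n≤bits)) (length≤size (order ∷ k ∷ bits))
  where
  open Graph G
  row : V → List ℕ
  row u = map (λ v → bit (adj u v)) (allFin order)
  bits : List ℕ
  bits = concatMap row (allFin order)
  n≤bits : order ≤ length bits
  n≤bits = ≤-trans (≤-reflexive (sym (length-allFin order))) (length-concatMap-≥ row
    (λ u → ≤-trans (>-nonZero⁻¹ order {{nonEmpty}})
      (≤-reflexive (sym (trans (length-map _ (allFin order)) (length-allFin order)))))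
    (allFin order))

sizeTerm : Term 0
sizeTerm = ∑ (input (lit 0)) ⊕ (input (lit 0) ⊕ input (lit 0) ⊕ lit 2)

sizeBound-computable : Computable sizeBound
sizeBound-computable = program (print sizeTerm) , λ n →
  let t , run , _ = program-correct (print sizeTerm) (n ∷ [])
  in t , subst (λ x → program (print sizeTerm) maps n ∷ [] to x ∷ [] within t) (cong (_+ (n + n + 2)) (sum-const n n)) run

-- Polynomial running time

-- The base `suc n` is never 0, so powers grow with the exponent; sums can then use the sum of the
-- exponents in place of their maximum.
PolynomiallyBounded : (ℕ → ℕ) → Set
PolynomiallyBounded g = ∃[ c ] ∃[ d ] ∀ n → g n ≤ c * suc n ^ d

const-bounded : ∀ c → PolynomiallyBounded (const c)
const-bounded c = c , 0 , λ n → ≤-reflexive (sym (*-identityʳ c))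

+-bounded : ∀ {f g} → PolynomiallyBounded f → PolynomiallyBounded g → PolynomiallyBounded (λ n → f n + g n)
+-bounded {f} {g} (c , d , p) (c′ , d′ , p′) = c + c′ , d + d′ , λ n → begin
  f n + g n                                         ≤⟨ +-mono-≤ (p n) (p′ n) ⟩
  c * suc n ^ d + c′ * suc n ^ d′
    ≤⟨ +-mono-≤ (*-monoʳ-≤ c (^-monoʳ-≤ (suc n) (m≤m+n d d′))) (*-monoʳ-≤ c′ (^-monoʳ-≤ (suc n) (m≤n+m d′ d))) ⟩
  c * suc n ^ (d + d′) + c′ * suc n ^ (d + d′)      ≡⟨ *-distribʳ-+ (suc n ^ (d + d′)) c c′ ⟨
  (c + c′) * suc n ^ (d + d′)                       ∎
  where open ≤-Reasoning

n*-bounded : ∀ {f} → PolynomiallyBounded f → PolynomiallyBounded (λ n → n * f n)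
n*-bounded {f} (c , d , p) = c , suc d , λ n → begin
  n * f n                   ≤⟨ *-mono-≤ (n≤1+n n) (p n) ⟩
  suc n * (c * suc n ^ d)   ≡⟨ *-assoc (suc n) c _ ⟨
  suc n * c * suc n ^ d     ≡⟨ cong (_* suc n ^ d) (*-comm (suc n) c) ⟩
  c * suc n * suc n ^ d     ≡⟨ *-assoc c (suc n) _ ⟩
  c * suc n ^ suc d         ∎
  where open ≤-Reasoning

countUpTime-bounded : ∀ {f} → PolynomiallyBounded f → PolynomiallyBounded (λ n → countUpTime n (f n))
countUpTime-bounded p = +-bounded (const-bounded 3) (+-bounded
  (n*-bounded (+-bounded (const-bounded 6) (+-bounded p (const-bounded 6)))) (const-bounded 6))

termTime-bounded : ∀ {v} (e : Term v) → PolynomiallyBounded (termTime e)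
termTime-bounded (lit _)   = const-bounded 3
termTime-bounded (var _)   = const-bounded 4
termTime-bounded (input e) = +-bounded (termTime-bounded e) (const-bounded 5)
termTime-bounded (work e)  = +-bounded (termTime-bounded e) (const-bounded 5)
termTime-bounded (d ⊕ e)   = +-bounded (termTime-bounded d) (+-bounded (termTime-bounded e) (const-bounded 7))
termTime-bounded (d ⊖ e)   = +-bounded (termTime-bounded d) (+-bounded (termTime-bounded e) (const-bounded 7))
termTime-bounded (∑ e)     = +-bounded (const-bounded 3)
  (countUpTime-bounded (+-bounded (termTime-bounded e) (const-bounded 7)))

commandTime-bounded : ∀ {v} (c : Command v) → PolynomiallyBounded (commandTime c)
commandTime-bounded skip         = const-bounded 1
commandTime-bounded (print e)    = +-bounded (termTime-bounded e) (const-bounded 3)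
commandTime-bounded (store d e)  = +-bounded (termTime-bounded d) (+-bounded (termTime-bounded e) (const-bounded 5))
commandTime-bounded (c ⨾ d)      = +-bounded (commandTime-bounded c) (commandTime-bounded d)
commandTime-bounded (ifnz e c d) = +-bounded (termTime-bounded e)
  (+-bounded (const-bounded 3) (+-bounded (commandTime-bounded c) (commandTime-bounded d)))
commandTime-bounded (for c)      = countUpTime-bounded (commandTime-bounded c)

command-polynomialTime : ∀ K c → PolynomiallyBounded (commandTime c) →
  (∀ I → result c (encodeCR I) ≡ encodeCR (K I)) → PolynomialTime CopsAndRobber/nd K
command-polynomialTime K c (a , d , bound) correct = program c , a , d , λ I →
  let t , run , t≤ = program-correct c (encodeCR I)
      n = Graph.order (CRInstance.graph I)
  in t , subst (λ ys → program c maps encodeCR I to ys within t) (correct I) run , (begin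
    t                             ≤⟨ t≤ ⟩
    commandTime c n               ≤⟨ bound n ⟩
    a * suc n ^ d                 ≤⟨ *-monoʳ-≤ a (^-monoˡ-≤ d (order<size-encodeCR I)) ⟩
    a * size (encodeCR I) ^ d     ≤⟨ m≤m+n _ a ⟩
    a * size (encodeCR I) ^ d + a ∎)
  where open ≤-Reasoning

theorem5 : ∃ λ (K : CRInstance → CRInstance) →
    IsKernel CopsAndRobber/nd K
    × (∀ I → Graph.order (CRInstance.graph (K I)) ≤ nd (CRInstance.graph I))
theorem5 = kernel , record
  { polynomialTime = command-polynomialTime kernel kernelCommand
      (commandTime-bounded kernelCommand) kernelCommand-result
  ; equivalent     = kernel-equivalent
  ; bounded        = sizeBound , sizeBound-computable , λ I →
      size-encodeCR (kernel I) (kernelOrder≤nd I) (≤-trans (kernelCops≤order I) (kernelOrder≤nd I))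
  } , kernelOrder≤nd
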